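{- Let $s\in\mathbb{N}$, $l\in\mathbb{N}$, $k_1,\dots,k_l,t_1,\dots,t_l\in\mathbb{N}'$ and $m_1,\dots,m_l\in\mathbb{Z}$, and put $K=k_1t_1+\cdots+k_lt_l$. Then the $Z$ transform of the sequence $n\mapsto F_{t_1sn+m_1}^{k_1}\cdots F_{t_lsn+m_l}^{k_l}$ is $$\mathcal{Z}\left(F_{t_1sn+m_1}^{k_1}\cdots F_{t_lsn+m_l}^{k_l}\right)=z\,\frac{\displaystyle\sum_{i=0}^{K}\sum_{j=0}^{i}(-1)^{\frac{(sj+2(s+1))(j+1)}{2}}\binom{K+1}{j}_{F_s}F_{m_1+t_1s(i-j)}^{k_1}\cdots F_{m_l+t_ls(i-j)}^{k_l}\,y^{\frac{sj(j-1)}{2}}z^{K-i}}{\displaystyle\sum_{i=0}^{K+1}(-1)^{\frac{(si+2(s+1))(i+1)}{2}}\binom{K+1}{i}_{F_s}y^{\frac{si(i-1)}{2}}z^{K+1-i}}.$$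
   Context: $\mathbb{N}=\{1,2,\dots\}$, $\mathbb{N}'=\mathbb{N}\cup\{0\}$. $x,y$ are indeterminates and we abbreviate $F_n=F_n(x,y)$. The bivariate Fibonacci polynomials are $F_0=0$, $F_1=1$, $F_{n+2}=xF_{n+1}+yF_n$, extended to negative indices by $F_{ -n}=-(-y)^{ -n}F_n$ ($n\in\mathbb{N}$). For $n,k\in\mathbb{N}'$ the bivariate $s$-Fibopolynomial is $\binom{n}{k}_{F_s}=\frac{F_{sn}F_{s(n-1)}\cdots F_{s(n-k+1)}}{F_sF_{2s}\cdots F_{ks}}$ (equal to $1$ for $k=0$ and $k=n$, and to $0$ if $k>n$). The $Z$ transform of a sequence $(a_n)_{n\ge0}$ is $\mathcal{Z}(a_n)=\sum_{n\ge0}a_nz^{ -n}$, regarded as a formal power series in $z^{ -1}$ with coefficients in $\mathbb{C}(x,y)$ (equivalently, for fixed complex $x,y$ with $y\neq0$, as a function of $z$ for $|z|$ large). Zeroth powers equal $1$. -}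

module Defs where

open import Level using (Level; _⊔_) renaming (suc to lsuc)
open import Algebra.Bundles using (CommutativeRing)
open import Algebra.Apartness.Bundles using (HeytingField)
import Algebra.Apartness.Properties.HeytingCommutativeRing as HeytingProperties
import Algebra.Properties.CommutativeMonoid.Sum as CommutativeMonoidSum
import Algebra.Properties.Group as GroupProperties
import Algebra.Properties.Ring as RingProperties
import Algebra.Properties.Semiring.Exp as SemiringExp
import Algebra.Properties.Semiring.Sum as SemiringSum
import Algebra.Solver.Ring.NaturalCoefficients.Default as SemiringSolver
open import Data.Fin.Base using (Fin; toℕ) renaming (zero to fzero; suc to fsuc)
open import Data.Integer.Base using (ℤ; +_; -[1+_])
open import Data.Nat.Base using (ℕ; zero; suc; NonZero; _/_; _≤_; s≤s) renaming (_+_ to _+ℕ_; _*_ to _*ℕ_; _∸_ to _∸ℕ_; _⊔_ to _⊔ℕ_)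
import Data.Nat.Properties as ℕ
open import Data.Product.Base using (_,_; proj₁; proj₂)
open import Data.Sum.Base using (inj₁; inj₂)
open import Data.Vec.Functional using (Vector)
open import Relation.Binary.PropositionalEquality.Core using (subst)
import Relation.Binary.Reasoning.Setoid as SetoidReasoning
open import Relation.Nullary.Negation using (¬_)

-- Classically ≈-stable is automatic.  It holds in every Heyting field, is
-- inherited by all constructions below, and is what allows fractions to have
-- denominators that are merely nonzero.
record IntegralDomain c ℓ : Set (lsuc (c ⊔ ℓ)) where
  field
    commutativeRing : CommutativeRing c ℓ
  open CommutativeRing commutativeRing public
  field
    1≉0      : ¬ (1# ≈ 0#)
    *-≉0     : ∀ {a b} → ¬ (a ≈ 0#) → ¬ (b ≈ 0#) → ¬ (a * b ≈ 0#)
    ≈-stable : ∀ {a b} → ¬ ¬ (a ≈ b) → a ≈ b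

module DomainProperties {c ℓ : Level} (D : IntegralDomain c ℓ) where
  open IntegralDomain D
  open SemiringExp semiring using (_^_)
  open RingProperties ring using (-‿distribʳ-*)
  open GroupProperties +-group using (x∙y⁻¹≈ε⇒x≈y)
  open SetoidReasoning setoid

  *-cancelˡ : ∀ {a b d} → ¬ (d ≈ 0#) → d * a ≈ d * b → a ≈ b
  *-cancelˡ {a} {b} {d} d≉0 da≈db = ≈-stable λ a≉b →
    *-≉0 d≉0 (λ a-b≈0 → a≉b (x∙y⁻¹≈ε⇒x≈y a b a-b≈0)) (begin
      d * (a - b)         ≈⟨ distribˡ d a (- b) ⟩
      d * a + d * (- b)   ≈⟨ +-cong da≈db (sym (-‿distribʳ-* d b)) ⟩
      d * b - d * b       ≈⟨ -‿inverseʳ (d * b) ⟩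
      0#                  ∎)

  -‿≉0 : ∀ {a} → ¬ (a ≈ 0#) → ¬ (- a ≈ 0#)
  -‿≉0 {a} a≉0 -a≈0 = a≉0 (begin
    a        ≈⟨ sym (+-identityʳ a) ⟩
    a + 0#   ≈⟨ +-congˡ (sym -a≈0) ⟩
    a - a    ≈⟨ -‿inverseʳ a ⟩
    0#       ∎)

  ^-≉0 : ∀ {a} n → ¬ (a ≈ 0#) → ¬ (a ^ n ≈ 0#)
  ^-≉0 zero    a≉0 = 1≉0
  ^-≉0 (suc n) a≉0 = *-≉0 a≉0 (^-≉0 n a≉0)

  ∏-≉0 : ∀ {n} (f : Vector Carrier n) → (∀ i → ¬ (f i ≈ 0#)) →
         ¬ (CommutativeMonoidSum.sum *-commutativeMonoid f ≈ 0#)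
  ∏-≉0 {zero}  f f≉0 = 1≉0
  ∏-≉0 {suc n} f f≉0 = *-≉0 (f≉0 fzero) (∏-≉0 (λ i → f (fsuc i)) (λ i → f≉0 (fsuc i)))

fieldDomain : {c ℓ₁ ℓ₂ : Level} → HeytingField c ℓ₁ ℓ₂ → IntegralDomain c ℓ₁
fieldDomain k = record
  { commutativeRing = HeytingCommutativeRing.commutativeRing heytingCommutativeRing
  ; 1≉0             = λ 1≈0 → proj₂ (tight 1# 0#) 1≈0 1#0
  ; *-≉0            = λ {a} {b} a≉0 b≉0 ab≈0 →
      a≉0 (proj₁ (tight a 0#) λ a#0 →
      b≉0 (proj₁ (tight b 0#) λ b#0 →
      proj₂ (tight (a * b) 0#) ab≈0 (x#0y#0→xy#0 a#0 b#0)))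
  ; ≈-stable        = λ {a} {b} nn →
      proj₁ (tight a b) λ a#b → nn λ a≈b → proj₂ (tight a b) a≈b a#b
  }
  where
  open import Algebra.Apartness.Bundles using (HeytingCommutativeRing)
  open HeytingField k
  open HeytingProperties heytingCommutativeRing using (1#0; x#0y#0→xy#0)

-- D[[w]]: a power series is its sequence of coefficients.
module PowerSeries {c ℓ : Level} (D : IntegralDomain c ℓ) where
  private
    module D = IntegralDomain D
  open D using (Carrier; 0#; 1#)
  open SemiringSum D.semiring using (sum⁺-syntax)

  Series : Set c
  Series = ℕ → Carrier

  infix  4 _≈_
  infixl 6 _+_
  infixl 7 _*_
  infix  8 -_

  record _≈_ (a b : Series) : Set ℓ where
    constructor coeffwise
    field at : ∀ n → a n D.≈ b n
  open _≈_ public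

  _+_ _*_ : Series → Series → Series
  (a + b) n = a n D.+ b n
  (a * b) n = ∑[ i ≤ n ] (a (toℕ i) D.* b (n ∸ℕ toℕ i))

  -_ : Series → Series
  (- a) n = D.- a n

  const : Carrier → Series
  const a zero    = a
  const a (suc n) = 0#

  var : Series
  var zero          = 0#
  var (suc zero)    = 1#
  var (suc (suc n)) = 0#

  private
    open SetoidReasoning D.setoid

    tail : Series → Series
    tail a n = a (suc n)

    scale : Carrier → Series → Series
    scale r a n = r D.* a n

    term : Series → Series → ∀ n → Vector Carrier (suc n)
    term a b n i = a (toℕ i) D.* b (n ∸ℕ toℕ i)

    *-cong′ : ∀ {a a′ b b′} → (∀ n → a n D.≈ a′ n) → (∀ n → b n D.≈ b′ n) →
              ∀ n → (a * b) n D.≈ (a′ * b′) n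
    *-cong′ {a} {a′} {b} {b′} p q n = SemiringSum.sum-cong-≋ D.semiring {suc n} {term a b n} {term a′ b′ n}
      (λ i → D.*-cong (p (toℕ i)) (q (n ∸ℕ toℕ i)))

    scale-* : ∀ r a b n → (scale r a * b) n D.≈ r D.* (a * b) n
    scale-* r a b n = D.trans
      (SemiringSum.sum-cong-≋ D.semiring {suc n} {term (scale r a) b n} {λ i → r D.* term a b n i}
        (λ i → D.*-assoc r (a (toℕ i)) (b (n ∸ℕ toℕ i))))
      (D.sym (SemiringSum.*-distribˡ-sum D.semiring r (term a b n)))

    distribʳ′ : ∀ a b d n → ((b + d) * a) n D.≈ (b * a + d * a) n
    distribʳ′ a b d n = D.trans
      (SemiringSum.sum-cong-≋ D.semiring {suc n} {term (b + d) a n} {λ i → term b a n i D.+ term d a n i}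
        (λ i → D.distribʳ (a (n ∸ℕ toℕ i)) (b (toℕ i)) (d (toℕ i))))
      (SemiringSum.∑-distrib-+ D.semiring (term b a n) (term d a n))

    *-suc : ∀ a b n → (a * b) (suc n) D.≈ (a * tail b) n D.+ a (suc n) D.* b 0
    *-suc a b zero    = D.trans (D.+-congˡ (D.+-identityʳ _)) (D.+-congʳ (D.sym (D.+-identityʳ _)))
    *-suc a b (suc n) = D.trans (D.+-congˡ (*-suc (tail a) b n)) (D.sym (D.+-assoc _ _ _))

    *-comm′ : ∀ a b n → (a * b) n D.≈ (b * a) n
    *-comm′ a b zero    = D.+-congʳ (D.*-comm (a 0) (b 0))
    *-comm′ a b (suc n) = begin
      (a * b) (suc n)                         ≈⟨ *-suc a b n ⟩
      (a * tail b) n D.+ a (suc n) D.* b 0    ≈⟨ D.+-cong (*-comm′ a (tail b) n) (D.*-comm _ _) ⟩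
      (tail b * a) n D.+ b 0 D.* a (suc n)    ≈⟨ D.+-comm _ _ ⟩
      (b * a) (suc n)                         ∎

    *-assoc′ : ∀ a b d n → ((a * b) * d) n D.≈ (a * (b * d)) n
    *-assoc′ a b d zero = D.+-congʳ (begin
      (a 0 D.* b 0 D.+ 0#) D.* d 0    ≈⟨ D.*-congʳ (D.+-identityʳ _) ⟩
      (a 0 D.* b 0) D.* d 0           ≈⟨ D.*-assoc _ _ _ ⟩
      a 0 D.* (b 0 D.* d 0)           ≈⟨ D.*-congˡ (D.sym (D.+-identityʳ _)) ⟩
      a 0 D.* (b 0 D.* d 0 D.+ 0#)    ∎)
    *-assoc′ a b d (suc n) = begin
      (a 0 D.* b 0 D.+ 0#) D.* d (suc n) D.+ ((scale (a 0) (tail b) + tail a * b) * d) n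
        ≈⟨ D.+-cong (D.trans (D.*-congʳ (D.+-identityʳ _)) (D.*-assoc _ _ _))
             (D.trans (distribʳ′ d (scale (a 0) (tail b)) (tail a * b) n)
               (D.+-cong (scale-* (a 0) (tail b) d n) (*-assoc′ (tail a) b d n))) ⟩
      a 0 D.* (b 0 D.* d (suc n)) D.+ (a 0 D.* (tail b * d) n D.+ (tail a * (b * d)) n)
        ≈⟨ D.sym (D.+-assoc _ _ _) ⟩
      (a 0 D.* (b 0 D.* d (suc n)) D.+ a 0 D.* (tail b * d) n) D.+ (tail a * (b * d)) n
        ≈⟨ D.+-congʳ (D.sym (D.distribˡ _ _ _)) ⟩
      (a * (b * d)) (suc n) ∎

    zero-* : ∀ a b → (∀ n → a n D.≈ 0#) → ∀ n → (a * b) n D.≈ 0#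
    zero-* a b a≈0 n = D.trans
      (SemiringSum.sum-cong-≋ D.semiring {suc n} {term a b n} {λ _ → 0#}
        (λ i → D.trans (D.*-congʳ (a≈0 (toℕ i))) (D.zeroˡ (b (n ∸ℕ toℕ i)))))
      (SemiringSum.sum-replicate-zero D.semiring (suc n))

    *-identityˡ′ : ∀ a n → (const 1# * a) n D.≈ a n
    *-identityˡ′ a zero    = D.trans (D.+-identityʳ _) (D.*-identityˡ _)
    *-identityˡ′ a (suc n) = D.trans
      (D.+-cong (D.*-identityˡ _) (zero-* (tail (const 1#)) a (λ _ → D.refl) n))
      (D.+-identityʳ _)

    const0 : ∀ n → const 0# n D.≈ 0#
    const0 zero    = D.refl
    const0 (suc n) = D.refl

  commutativeRing : CommutativeRing c ℓ
  commutativeRing = record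
    { Carrier = Series ; _≈_ = _≈_ ; _+_ = _+_ ; _*_ = _*_ ; -_ = -_
    ; 0# = const 0# ; 1# = const 1#
    ; isCommutativeRing = record
      { isRing = record
        { +-isAbelianGroup = record
          { isGroup = record
            { isMonoid = record
              { isSemigroup = record
                { isMagma = record
                  { isEquivalence = record
                    { refl  = coeffwise λ n → D.refl
                    ; sym   = λ p → coeffwise λ n → D.sym (at p n)
                    ; trans = λ p q → coeffwise λ n → D.trans (at p n) (at q n)
                    }
                  ; ∙-cong = λ p q → coeffwise λ n → D.+-cong (at p n) (at q n)
                  }
                ; assoc = λ a b d → coeffwise λ n → D.+-assoc (a n) (b n) (d n)
                }
              ; identity =
                ( (λ a → coeffwise λ n → D.trans (D.+-congʳ (const0 n)) (D.+-identityˡ (a n)))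
                , (λ a → coeffwise λ n → D.trans (D.+-congˡ (const0 n)) (D.+-identityʳ (a n))) )
              }
            ; inverse =
              ( (λ a → coeffwise λ n → D.trans (D.-‿inverseˡ (a n)) (D.sym (const0 n)))
              , (λ a → coeffwise λ n → D.trans (D.-‿inverseʳ (a n)) (D.sym (const0 n))) )
            ; ⁻¹-cong = λ p → coeffwise λ n → D.-‿cong (at p n)
            }
          ; comm = λ a b → coeffwise λ n → D.+-comm (a n) (b n)
          }
        ; *-cong     = λ p q → coeffwise (*-cong′ (at p) (at q))
        ; *-assoc    = λ a b d → coeffwise (*-assoc′ a b d)
        ; *-identity =
          ( (λ a → coeffwise (*-identityˡ′ a))
          , (λ a → coeffwise λ n → D.trans (*-comm′ a (const 1#) n) (*-identityˡ′ a n)) )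
        ; distrib    =
          ( (λ a b d → coeffwise λ n → begin
              (a * (b + d)) n         ≈⟨ *-comm′ a (b + d) n ⟩
              ((b + d) * a) n         ≈⟨ distribʳ′ a b d n ⟩
              (b * a + d * a) n       ≈⟨ D.+-cong (*-comm′ b a n) (*-comm′ d a n) ⟩
              (a * b + a * d) n       ∎)
          , (λ a b d → coeffwise (distribʳ′ a b d)) )
        }
      ; *-comm = λ a b → coeffwise (*-comm′ a b)
      }
    }

  private
    tail-zero : ∀ a b → a 0 D.≈ 0# → (∀ n → (a * b) n D.≈ 0#) → ∀ n → (tail a * b) n D.≈ 0#
    tail-zero a b a₀≈0 ab≈0 n = begin
      (tail a * b) n                               ≈⟨ D.sym (D.+-identityˡ _) ⟩
      0# D.+ (tail a * b) n                        ≈⟨ D.+-congʳ (D.sym (D.zeroˡ _)) ⟩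
      0# D.* b (suc n) D.+ (tail a * b) n          ≈⟨ D.+-congʳ (D.*-congʳ (D.sym a₀≈0)) ⟩
      (a * b) (suc n)                              ≈⟨ ab≈0 (suc n) ⟩
      0#                                           ∎

    nzd₀ : ∀ j a b → ¬ (a 0 D.≈ 0#) → ¬ (b j D.≈ 0#) → ¬ (∀ n → (a * b) n D.≈ 0#)
    nzd₀ j a b a₀≉0 bⱼ≉0 ab≈0 = D.*-≉0 a₀≉0 (b₀≉0 j bⱼ≉0)
      (D.trans (D.sym (D.+-identityʳ _)) (ab≈0 0))
      where
      b₀≉0 : ∀ j → ¬ (b j D.≈ 0#) → ¬ (b 0 D.≈ 0#)
      b₀≉0 zero    h      = h
      b₀≉0 (suc j) h b₀≈0 = nzd₀ j a (tail b) a₀≉0 h λ n →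
        D.trans (*-comm′ a (tail b) n)
          (tail-zero b a b₀≈0 (λ n → D.trans (*-comm′ b a n) (ab≈0 n)) n)

    nzd : ∀ i j a b → ¬ (a i D.≈ 0#) → ¬ (b j D.≈ 0#) → ¬ (∀ n → (a * b) n D.≈ 0#)
    nzd zero    j a b aᵢ≉0 bⱼ≉0 ab≈0 = nzd₀ j a b aᵢ≉0 bⱼ≉0 ab≈0
    nzd (suc i) j a b aᵢ≉0 bⱼ≉0 ab≈0 = nzd₀ j a b
      (λ a₀≈0 → nzd i j (tail a) b aᵢ≉0 bⱼ≉0 (tail-zero a b a₀≈0 ab≈0)) bⱼ≉0 ab≈0

    some-coeff≉0 : ∀ {a} → ¬ (a ≈ const 0#) → ¬ (∀ i → ¬ ¬ (a i D.≈ 0#))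
    some-coeff≉0 a≉0 h = a≉0 (coeffwise λ n → D.trans (D.≈-stable (h n)) (D.sym (const0 n)))

  integralDomain : IntegralDomain c ℓ
  integralDomain = record
    { commutativeRing = commutativeRing
    ; 1≉0             = λ p → D.1≉0 (at p 0)
    ; *-≉0            = λ {a} {b} a≉0 b≉0 ab≈0 →
        some-coeff≉0 a≉0 λ i aᵢ≉0 → some-coeff≉0 b≉0 λ j bⱼ≉0 →
        nzd i j a b aᵢ≉0 bⱼ≉0 λ n → D.trans (at ab≈0 n) (const0 n)
    ; ≈-stable        = λ nn → coeffwise λ n → D.≈-stable λ h → nn λ p → h (at p n)
    }

  var≉0 : ¬ (var ≈ const 0#)
  var≉0 p = D.1≉0 (at p 1)

-- D[w], as the subring of D[[w]] of series with finite support.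
module Polynomials {c ℓ : Level} (D : IntegralDomain c ℓ) where
  private
    module D = IntegralDomain D
    module S = PowerSeries D
    module R = IntegralDomain S.integralDomain
  open D using (Carrier; 0#; 1#)

  record Polynomial : Set (c ⊔ ℓ) where
    constructor polynomial
    field
      coeff     : ℕ → Carrier
      bound     : ℕ
      vanishing : ∀ n → bound ≤ n → coeff n D.≈ 0#
  open Polynomial public

  infix  4 _≈_
  infixl 6 _+_
  infixl 7 _*_
  infix  8 -_

  record _≈_ (p q : Polynomial) : Set ℓ where
    constructor series≈
    field coeff≈ : coeff p S.≈ coeff q
  open _≈_ public

  _+_ _*_ : Polynomial → Polynomial → Polynomial
  coeff     (p + q)      = coeff p S.+ coeff q
  bound     (p + q)      = bound p ⊔ℕ bound q
  vanishing (p + q) n le = D.trans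
    (D.+-cong (vanishing p n (ℕ.m⊔n≤o⇒m≤o (bound p) (bound q) le))
              (vanishing q n (ℕ.m⊔n≤o⇒n≤o (bound p) (bound q) le)))
    (D.+-identityˡ 0#)
  coeff     (p * q)      = coeff p S.* coeff q
  bound     (p * q)      = bound p +ℕ bound q
  vanishing (p * q) n le = D.trans
    (SemiringSum.sum-cong-≋ D.semiring {suc n} {λ i → coeff p (toℕ i) D.* coeff q (n ∸ℕ toℕ i)} {λ _ → 0#}
      (λ i → term (toℕ i)))
    (SemiringSum.sum-replicate-zero D.semiring (suc n))
    where
    term : ∀ i → coeff p i D.* coeff q (n ∸ℕ i) D.≈ 0#
    term i with ℕ.≤-total (bound p) i
    ... | inj₁ p≤i = D.trans (D.*-congʳ (vanishing p i p≤i)) (D.zeroˡ _)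
    ... | inj₂ i≤p = D.trans (D.*-congˡ (vanishing q (n ∸ℕ i) q≤n-i)) (D.zeroʳ _)
      where
      q≤n-i : bound q ≤ n ∸ℕ i
      q≤n-i = ℕ.m+n≤o⇒m≤o∸n (bound q) (ℕ.≤-trans
        (ℕ.+-monoʳ-≤ (bound q) i≤p)
        (subst (_≤ n) (ℕ.+-comm (bound p) (bound q)) le))

  -_ : Polynomial → Polynomial
  coeff     (- p)      = S.- coeff p
  bound     (- p)      = bound p
  vanishing (- p) n le = D.trans (D.-‿cong (vanishing p n le)) (RingProperties.-0#≈0# D.ring)

  const : Carrier → Polynomial
  coeff     (const a)           = S.const a
  bound     (const a)           = 1
  vanishing (const a) (suc n) _ = D.refl

  var : Polynomial
  coeff     var                   = S.var
  bound     var                   = 2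
  vanishing var (suc zero) (s≤s ())
  vanishing var (suc (suc n)) _   = D.refl

  commutativeRing : CommutativeRing (c ⊔ ℓ) ℓ
  commutativeRing = record
    { Carrier = Polynomial ; _≈_ = _≈_ ; _+_ = _+_ ; _*_ = _*_ ; -_ = -_
    ; 0# = const 0# ; 1# = const 1#
    ; isCommutativeRing = record
      { isRing = record
        { +-isAbelianGroup = record
          { isGroup = record
            { isMonoid = record
              { isSemigroup = record
                { isMagma = record
                  { isEquivalence = record
                    { refl  = series≈ R.refl
                    ; sym   = λ p → series≈ (R.sym (coeff≈ p))
                    ; trans = λ p q → series≈ (R.trans (coeff≈ p) (coeff≈ q))
                    }
                  ; ∙-cong = λ p q → series≈ (R.+-cong (coeff≈ p) (coeff≈ q))
                  }
                ; assoc = λ a b d → series≈ (R.+-assoc (coeff a) (coeff b) (coeff d))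
                }
              ; identity =
                ( (λ a → series≈ (R.+-identityˡ (coeff a)))
                , (λ a → series≈ (R.+-identityʳ (coeff a))) )
              }
            ; inverse =
              ( (λ a → series≈ (R.-‿inverseˡ (coeff a)))
              , (λ a → series≈ (R.-‿inverseʳ (coeff a))) )
            ; ⁻¹-cong = λ p → series≈ (R.-‿cong (coeff≈ p))
            }
          ; comm = λ a b → series≈ (R.+-comm (coeff a) (coeff b))
          }
        ; *-cong     = λ p q → series≈ (R.*-cong (coeff≈ p) (coeff≈ q))
        ; *-assoc    = λ a b d → series≈ (R.*-assoc (coeff a) (coeff b) (coeff d))
        ; *-identity =
          ( (λ a → series≈ (R.*-identityˡ (coeff a)))
          , (λ a → series≈ (R.*-identityʳ (coeff a))) )
        ; distrib    =
          ( (λ a b d → series≈ (R.distribˡ (coeff a) (coeff b) (coeff d)))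
          , (λ a b d → series≈ (R.distribʳ (coeff a) (coeff b) (coeff d))) )
        }
      ; *-comm = λ a b → series≈ (R.*-comm (coeff a) (coeff b))
      }
    }

  integralDomain : IntegralDomain (c ⊔ ℓ) ℓ
  integralDomain = record
    { commutativeRing = commutativeRing
    ; 1≉0             = λ p → R.1≉0 (coeff≈ p)
    ; *-≉0            = λ a≉0 b≉0 ab≈0 →
        R.*-≉0 (λ p → a≉0 (series≈ p)) (λ p → b≉0 (series≈ p)) (coeff≈ ab≈0)
    ; ≈-stable        = λ nn → series≈ (R.≈-stable λ h → nn λ p → h (coeff≈ p))
    }

  var≉0 : ¬ (var ≈ const 0#)
  var≉0 p = S.var≉0 (coeff≈ p)

-- The field of fractions of D.
module Fractions {c ℓ : Level} (D : IntegralDomain c ℓ) where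
  private
    module D = IntegralDomain D
  open D using (Carrier; 0#; 1#)
  open DomainProperties D using (*-cancelˡ)
  open RingProperties D.ring using (-‿distribˡ-*)
  open SetoidReasoning D.setoid
  open SemiringSolver D.commutativeSemiring using (solve; _:=_; _:+_; _:*_)

  record Fraction : Set (c ⊔ ℓ) where
    constructor fraction
    field
      num   : Carrier
      den   : Carrier
      den≉0 : ¬ (den D.≈ 0#)
  open Fraction public

  infix  4 _≈_
  infixl 6 _+_
  infixl 7 _*_ _÷_[_]
  infix  8 -_

  record _≈_ (p q : Fraction) : Set ℓ where
    constructor cross
    field cross≈ : num p D.* den q D.≈ num q D.* den p
  open _≈_ public

  ι : Carrier → Fraction
  num   (ι a) = a
  den   (ι a) = 1#
  den≉0 (ι a) = D.1≉0

  _+_ _*_ : Fraction → Fraction → Fraction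
  num   (p + q) = num p D.* den q D.+ num q D.* den p
  den   (p + q) = den p D.* den q
  den≉0 (p + q) = D.*-≉0 (den≉0 p) (den≉0 q)
  num   (p * q) = num p D.* num q
  den   (p * q) = den p D.* den q
  den≉0 (p * q) = D.*-≉0 (den≉0 p) (den≉0 q)

  -_ : Fraction → Fraction
  num   (- p) = D.- num p
  den   (- p) = den p
  den≉0 (- p) = den≉0 p

  num≉0 : ∀ {p} → ¬ (p ≈ ι 0#) → ¬ (num p D.≈ 0#)
  num≉0 p≉0 n≈0 = p≉0 (cross (D.trans (D.*-congʳ n≈0) (D.trans (D.zeroˡ _) (D.sym (D.zeroˡ _)))))

  _÷_[_] : (p q : Fraction) → ¬ (q ≈ ι 0#) → Fraction
  num   (p ÷ q [ q≉0 ]) = num p D.* den q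
  den   (p ÷ q [ q≉0 ]) = den p D.* num q
  den≉0 (p ÷ q [ q≉0 ]) = D.*-≉0 (den≉0 p) (num≉0 q≉0)

  private
    ≈-trans : ∀ {p q r} → p ≈ q → q ≈ r → p ≈ r
    ≈-trans {fraction a b _} {fraction d e e≉0} {fraction f g _} (cross ae≈db) (cross dg≈fe) =
      cross (*-cancelˡ e≉0 (begin
        e D.* (a D.* g)    ≈⟨ solve 3 (λ e a g → e :* (a :* g) := (a :* e) :* g) D.refl e a g ⟩
        (a D.* e) D.* g    ≈⟨ D.*-congʳ ae≈db ⟩
        (d D.* b) D.* g    ≈⟨ solve 3 (λ d b g → (d :* b) :* g := (d :* g) :* b) D.refl d b g ⟩
        (d D.* g) D.* b    ≈⟨ D.*-congʳ dg≈fe ⟩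
        (f D.* e) D.* b    ≈⟨ solve 3 (λ f e b → (f :* e) :* b := e :* (f :* b)) D.refl f e b ⟩
        e D.* (f D.* b)    ∎))

    +-cong : ∀ {p p′ q q′} → p ≈ p′ → q ≈ q′ → p + q ≈ p′ + q′
    +-cong {fraction a b _} {fraction a′ b′ _} {fraction d e _} {fraction d′ e′ _} (cross p) (cross q) =
      cross (begin
        (a D.* e D.+ d D.* b) D.* (b′ D.* e′)
          ≈⟨ solve 6 (λ a b d e b′ e′ → (a :* e :+ d :* b) :* (b′ :* e′)
               := (a :* b′) :* (e :* e′) :+ (d :* e′) :* (b :* b′)) D.refl a b d e b′ e′ ⟩
        (a D.* b′) D.* (e D.* e′) D.+ (d D.* e′) D.* (b D.* b′)
          ≈⟨ D.+-cong (D.*-congʳ p) (D.*-congʳ q) ⟩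
        (a′ D.* b) D.* (e D.* e′) D.+ (d′ D.* e) D.* (b D.* b′)
          ≈⟨ solve 6 (λ a′ b d′ e b′ e′ → (a′ :* b) :* (e :* e′) :+ (d′ :* e) :* (b :* b′)
               := (a′ :* e′ :+ d′ :* b′) :* (b :* e)) D.refl a′ b d′ e b′ e′ ⟩
        (a′ D.* e′ D.+ d′ D.* b′) D.* (b D.* e) ∎)

    *-cong : ∀ {p p′ q q′} → p ≈ p′ → q ≈ q′ → p * q ≈ p′ * q′
    *-cong {fraction a b _} {fraction a′ b′ _} {fraction d e _} {fraction d′ e′ _} (cross p) (cross q) =
      cross (begin
        (a D.* d) D.* (b′ D.* e′)  ≈⟨ solve 4 (λ a d b′ e′ → (a :* d) :* (b′ :* e′) := (a :* b′) :* (d :* e′)) D.refl a d b′ e′ ⟩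
        (a D.* b′) D.* (d D.* e′)  ≈⟨ D.*-cong p q ⟩
        (a′ D.* b) D.* (d′ D.* e)  ≈⟨ solve 4 (λ a′ b d′ e → (a′ :* b) :* (d′ :* e) := (a′ :* d′) :* (b :* e)) D.refl a′ b d′ e ⟩
        (a′ D.* d′) D.* (b D.* e)  ∎)

    -‿cong : ∀ {p q} → p ≈ q → - p ≈ - q
    -‿cong {fraction a b _} {fraction d e _} (cross p) = cross (begin
      (D.- a) D.* e     ≈⟨ D.sym (-‿distribˡ-* a e) ⟩
      D.- (a D.* e)     ≈⟨ D.-‿cong p ⟩
      D.- (d D.* b)     ≈⟨ -‿distribˡ-* d b ⟩
      (D.- d) D.* b     ∎)

    same-den : ∀ {p q} → num p D.≈ num q → den p D.≈ den q → p ≈ q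
    same-den n≈ d≈ = cross (D.*-cong n≈ (D.sym d≈))

    +-assoc : ∀ p q r → (p + q) + r ≈ p + (q + r)
    +-assoc (fraction a b _) (fraction d e _) (fraction f g _) = same-den
      (solve 6 (λ a b d e f g → (a :* e :+ d :* b) :* g :+ f :* (b :* e)
         := a :* (e :* g) :+ (d :* g :+ f :* e) :* b) D.refl a b d e f g)
      (D.*-assoc b e g)

    +-comm : ∀ p q → p + q ≈ q + p
    +-comm p q = same-den (D.+-comm _ _) (D.*-comm _ _)

    +-identityˡ : ∀ p → ι 0# + p ≈ p
    +-identityˡ (fraction a b _) = same-den
      (D.trans (D.+-cong (D.zeroˡ b) (D.*-identityʳ a)) (D.+-identityˡ a)) (D.*-identityˡ b)

    -‿inverseˡ : ∀ p → (- p) + p ≈ ι 0#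
    -‿inverseˡ (fraction a b _) = cross (begin
      ((D.- a) D.* b D.+ a D.* b) D.* 1#  ≈⟨ D.*-congʳ (D.sym (D.distribʳ b (D.- a) a)) ⟩
      ((D.- a D.+ a) D.* b) D.* 1#        ≈⟨ D.*-congʳ (D.*-congʳ (D.-‿inverseˡ a)) ⟩
      (0# D.* b) D.* 1#                   ≈⟨ D.*-congʳ (D.zeroˡ b) ⟩
      0# D.* 1#                           ≈⟨ D.zeroˡ 1# ⟩
      0#                                  ≈⟨ D.sym (D.zeroˡ _) ⟩
      0# D.* (b D.* b)                    ∎)

    *-comm : ∀ p q → p * q ≈ q * p
    *-comm p q = same-den (D.*-comm _ _) (D.*-comm _ _)

    *-identityˡ : ∀ p → ι 1# * p ≈ p
    *-identityˡ p = same-den (D.*-identityˡ _) (D.*-identityˡ _)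

    distribʳ : ∀ p q r → (q + r) * p ≈ q * p + r * p
    distribʳ (fraction a b _) (fraction d e _) (fraction f g _) = cross
      (solve 6 (λ a b d e f g → ((d :* g :+ f :* e) :* a) :* ((e :* b) :* (g :* b))
         := ((d :* a) :* (g :* b) :+ (f :* a) :* (e :* b)) :* ((e :* g) :* b)) D.refl a b d e f g)

  commutativeRing : CommutativeRing (c ⊔ ℓ) ℓ
  commutativeRing = record
    { Carrier = Fraction ; _≈_ = _≈_ ; _+_ = _+_ ; _*_ = _*_ ; -_ = -_
    ; 0# = ι 0# ; 1# = ι 1#
    ; isCommutativeRing = record
      { isRing = record
        { +-isAbelianGroup = record
          { isGroup = record
            { isMonoid = record
              { isSemigroup = record
                { isMagma = record
                  { isEquivalence = record
                    { refl  = cross D.refl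
                    ; sym   = λ p → cross (D.sym (cross≈ p))
                    ; trans = ≈-trans
                    }
                  ; ∙-cong = +-cong
                  }
                ; assoc = +-assoc
                }
              ; identity =
                ( (+-identityˡ)
                , (λ p → ≈-trans (+-comm p (ι 0#)) (+-identityˡ p)) )
              }
            ; inverse =
              ( (-‿inverseˡ)
              , (λ p → ≈-trans (+-comm p (- p)) (-‿inverseˡ p)) )
            ; ⁻¹-cong = -‿cong
            }
          ; comm = +-comm
          }
        ; *-cong     = *-cong
        ; *-assoc    = λ p q r → same-den (D.*-assoc _ _ _) (D.*-assoc _ _ _)
        ; *-identity =
          ( (*-identityˡ)
          , (λ p → ≈-trans (*-comm p (ι 1#)) (*-identityˡ p)) )
        ; distrib    =
          ( (λ p q r → ≈-trans (*-comm p (q + r))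
              (≈-trans (distribʳ p q r) (+-cong (*-comm q p) (*-comm r p))))
          , (distribʳ) )
        }
      ; *-comm = *-comm
      }
    }

  num≈0 : ∀ {p} → p ≈ ι 0# → num p D.≈ 0#
  num≈0 (cross e) = D.trans (D.sym (D.*-identityʳ _)) (D.trans e (D.zeroˡ _))

  integralDomain : IntegralDomain (c ⊔ ℓ) ℓ
  integralDomain = record
    { commutativeRing = commutativeRing
    ; 1≉0             = λ p → D.1≉0 (num≈0 p)
    ; *-≉0            = λ p≉0 q≉0 pq≈0 → D.*-≉0 (num≉0 p≉0) (num≉0 q≉0) (num≈0 pq≈0)
    ; ≈-stable        = λ nn → cross (D.≈-stable λ h → nn λ p → h (cross≈ p))
    }

  ι≉0 : ∀ {a} → ¬ (a D.≈ 0#) → ¬ (ι a ≈ ι 0#)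
  ι≉0 a≉0 p = a≉0 (num≈0 p)

-- The base field k is arbitrary; k = ℂ gives coefficients in ℂ(x,y).
-- Suffixes: ᶜ for operations on k(x,y), ᶻ on k(x,y)((z⁻¹)), ᴾ on k[x,y].
module Fibonacci {c ℓ₁ ℓ₂ : Level} (k : HeytingField c ℓ₁ ℓ₂) where

  module k[x]     = Polynomials (fieldDomain k)
  module k[x,y]   = Polynomials k[x].integralDomain
  module k⟨x,y⟩   = Fractions k[x,y].integralDomain
  module k⟨x,y⟩⟦z⁻¹⟧ = PowerSeries k⟨x,y⟩.integralDomain
  -- The field of formal Laurent series in z⁻¹, as the fraction field of the
  -- power series in z⁻¹.
  module k⟨x,y⟩⟪z⁻¹⟫ = Fractions k⟨x,y⟩⟦z⁻¹⟧.integralDomain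

  private
    module X  = IntegralDomain k[x].integralDomain
    module P  = IntegralDomain k[x,y].integralDomain
    module C  = IntegralDomain k⟨x,y⟩.integralDomain
    module L  = IntegralDomain k⟨x,y⟩⟪z⁻¹⟫.integralDomain
    module C∏ = CommutativeMonoidSum C.*-commutativeMonoid
    module L∑ = CommutativeMonoidSum L.+-commutativeMonoid
    open SemiringExp X.semiring using () renaming (_^_ to _^ˣ_)
    open k⟨x,y⟩ using (ι; _÷_[_])

  Coefficient : Set (c ⊔ ℓ₁)
  Coefficient = C.Carrier

  Laurent : Set (c ⊔ ℓ₁)
  Laurent = L.Carrier

  infix  4 _≈ᶜ_ _≈ᶻ_
  infixl 7 _*ᶜ_ _*ᶻ_ _÷ᶻ_[_]

  _≈ᶜ_ : Coefficient → Coefficient → Set ℓ₁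
  _≈ᶜ_ = C._≈_

  _*ᶜ_ : Coefficient → Coefficient → Coefficient
  _*ᶜ_ = C._*_

  open SemiringExp C.semiring public using () renaming (_^_ to infixr 8 _^ᶜ_)

  -1ᶜ : Coefficient
  -1ᶜ = C.- C.1#

  ∏ᶜ : ∀ n → (Fin n → Coefficient) → Coefficient
  ∏ᶜ n = C∏.sum {n}

  infixr 10 ∏ᶜ
  syntax ∏ᶜ n (λ i → a) = ∏ᶜ[ i < n ] a

  _≈ᶻ_ : Laurent → Laurent → Set ℓ₁
  _≈ᶻ_ = L._≈_

  0ᶻ : Laurent
  0ᶻ = L.0#

  _*ᶻ_ : Laurent → Laurent → Laurent
  _*ᶻ_ = L._*_

  open SemiringExp L.semiring public using () renaming (_^_ to infixr 8 _^ᶻ_)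

  _÷ᶻ_[_] : (p q : Laurent) → ¬ (q ≈ᶻ 0ᶻ) → Laurent
  _÷ᶻ_[_] = k⟨x,y⟩⟪z⁻¹⟫._÷_[_]

  ∑ᶻ : ℕ → (ℕ → Laurent) → Laurent
  ∑ᶻ n f = L∑.sum {suc n} (λ i → f (toℕ i))

  infixr 10 ∑ᶻ
  syntax ∑ᶻ n (λ i → a) = ∑ᶻ[ i ≤ n ] a

  constᶻ : Coefficient → Laurent
  constᶻ a = k⟨x,y⟩⟪z⁻¹⟫.ι (k⟨x,y⟩⟦z⁻¹⟧.const a)

  -- The reciprocal of the power series variable.
  z : Laurent
  z = k⟨x,y⟩⟪z⁻¹⟫.fraction (k⟨x,y⟩⟦z⁻¹⟧.const C.1#) k⟨x,y⟩⟦z⁻¹⟧.var k⟨x,y⟩⟦z⁻¹⟧.var≉0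

  -- The sequence itself is the coefficient sequence of Σₙ aₙ z⁻ⁿ.
  𝒵 : (ℕ → Coefficient) → Laurent
  𝒵 a = k⟨x,y⟩⟪z⁻¹⟫.ι a

  xᴾ yᴾ : P.Carrier
  xᴾ = k[x,y].const k[x].var
  yᴾ = k[x,y].var

  Fᴾ : ℕ → P.Carrier
  Fᴾ zero          = P.0#
  Fᴾ (suc zero)    = P.1#
  Fᴾ (suc (suc n)) = xᴾ P.* Fᴾ (suc n) P.+ yᴾ P.* Fᴾ n

  -- Fₙ₊₁ ≡ xⁿ modulo y.
  private
    Fᴾ-mod-y : ∀ n → k[x,y].coeff (Fᴾ (suc n)) 0 X.≈ k[x].var ^ˣ n
    Fᴾ-mod-y zero    = X.refl
    Fᴾ-mod-y (suc n) = begin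
      (f₁ X.* g₁ X.+ X.0#) X.+ (X.0# X.* g₀ X.+ X.0#)
        ≈⟨ X.+-cong (X.+-identityʳ (f₁ X.* g₁))
             (X.trans (X.+-identityʳ (X.0# X.* g₀)) (X.zeroˡ g₀)) ⟩
      f₁ X.* g₁ X.+ X.0#       ≈⟨ X.+-identityʳ (f₁ X.* g₁) ⟩
      f₁ X.* g₁                ≈⟨ X.*-congˡ {f₁} (Fᴾ-mod-y n) ⟩
      k[x].var ^ˣ suc n        ∎
      where
      open SetoidReasoning X.setoid
      f₁ = k[x].var
      g₁ = k[x,y].coeff (Fᴾ (suc n)) 0
      g₀ = k[x,y].coeff (Fᴾ n) 0

  Fᴾ≉0 : ∀ n .{{_ : NonZero n}} → ¬ (Fᴾ n P.≈ P.0#)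
  Fᴾ≉0 (suc n) F≈0 = DomainProperties.^-≉0 k[x].integralDomain n k[x].var≉0
    (X.trans (X.sym (Fᴾ-mod-y n)) (PowerSeries.at (k[x,y].coeff≈ F≈0) 0))

  y : Coefficient
  y = ι yᴾ

  [-y]^≉0 : ∀ n → ¬ ((C.- y) ^ᶜ n ≈ᶜ C.0#)
  [-y]^≉0 n = ^-≉0 n (-‿≉0 (k⟨x,y⟩.ι≉0 k[x,y].var≉0))
    where open DomainProperties k⟨x,y⟩.integralDomain using (^-≉0; -‿≉0)

  -- F₋ₙ = -(-y)⁻ⁿ Fₙ for n ≥ 1.
  F : ℤ → Coefficient
  F (+ n)      = ι (Fᴾ n)
  F (-[1+ n ]) = C.- (ι (Fᴾ (suc n)) ÷ (C.- y) ^ᶜ suc n [ [-y]^≉0 (suc n) ])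

  ∏F≉0 : ∀ s j .{{_ : NonZero s}} → ¬ (∏ᶜ[ i < j ] F (+ (s *ℕ suc (toℕ i))) ≈ᶜ C.0#)
  ∏F≉0 s j = DomainProperties.∏-≉0 k⟨x,y⟩.integralDomain {j} _ λ i →
    k⟨x,y⟩.ι≉0 (Fᴾ≉0 (s *ℕ suc (toℕ i)) {{ℕ.m*n≢0 s (suc (toℕ i))}})

  -- For j > n the factor i = n of the numerator is F₀ = 0, so truncated
  -- subtraction gives the value 0 required there.
  fibopolynomial : (s n j : ℕ) .{{_ : NonZero s}} → Coefficient
  fibopolynomial s n j =
    (∏ᶜ[ i < j ] F (+ (s *ℕ (n ∸ℕ toℕ i)))) ÷ (∏ᶜ[ i < j ] F (+ (s *ℕ suc (toℕ i)))) [ ∏F≉0 s j ]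

  -- The exponent is an integer: s j (j + 1) and 2 (s + 1) (j + 1) are even.
  sign : ℕ → ℕ → Coefficient
  sign s j = -1ᶜ ^ᶜ (((s *ℕ j +ℕ 2 *ℕ (s +ℕ 1)) *ℕ (j +ℕ 1)) / 2)

{-# OPTIONS --safe #-}

-- Idea.  Put w_j = F_{sj}, q = (-y)^s, and let c_{N,j} be the coefficients of the
-- denominator for N = K + 1.  A sequence of the form n ↦ F_{sn+p} satisfies
--   w_{i+j} G(n+i) = w_i G(n+i+j) + q^i w_j G(n),
-- and binom(N,j) w_{N-j} = w_N binom(N-1,j), binom(N,j) w_j = w_N binom(N-1,j-1).
-- Multiplying Σ_j c_{N,j} G(n+N-j) a(n+N-j) by w_N therefore splits it into a multiple of
-- Σ_j c_{N-1,j} a(n+1+(N-1)-j) and a multiple of Σ_j c_{N-1,j} a(n+(N-1)-j), so by induction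
-- every product of K such sequences is annihilated by c_{K+1}.  By the addition formula
-- n ↦ F_{tsn+m} is a linear combination of products of t of them.  Hence the product of
-- the given series with Σ_j c_{K+1,j} z^{-j} is a polynomial of degree at most K in z⁻¹.
module Submission where

open import Defs
open import Level using (Level; _⊔_)
open import Algebra.Apartness.Bundles using (HeytingField)
open import Algebra.Bundles using (CommutativeSemiring)
open import Algebra.Core using (Op₂)
open import Algebra.Properties.CommutativeMonoid.Sum using (sum)
import Algebra.Properties.CommutativeMonoid.Sum as CommutativeMonoidSum
import Algebra.Properties.CommutativeSemiring.Exp as CommutativeSemiringExp
import Algebra.Properties.Group as GroupProperties
import Algebra.Properties.Monoid.Sum as MonoidSum
import Algebra.Properties.Ring as RingProperties
import Algebra.Properties.Semiring.Exp as SemiringExp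
import Algebra.Properties.Semiring.Sum as SemiringSum
import Algebra.Solver.Ring.NaturalCoefficients.Default as SemiringSolver
open import Data.Fin using (Fin; toℕ; zero; suc)
import Data.Fin.Properties as Fin
open import Data.Integer as ℤ using (ℤ; +_; -[1+_])
import Data.Integer.Properties as ℤ
open import Data.Nat using (ℕ; zero; suc; NonZero; _+_; _*_; _∸_; _/_; _≤_; z≤n; s≤s; s≤s⁻¹)
open import Data.Nat.Divisibility using (divides-refl)
open import Data.Nat.DivMod using (+-distrib-/-∣ʳ; m*n/n≡m)
import Data.Nat.Properties as ℕ
open import Data.Nat.Properties using (+-0-commutativeMonoid)
open import Data.Nat.Solver using (module +-*-Solver)
open import Data.Product using (Σ-syntax; _×_; _,_; proj₁)
open import Relation.Binary.PropositionalEquality as ≡ using (_≡_)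
import Relation.Binary.Reasoning.Setoid as SetoidReasoning
open import Relation.Nullary using (¬_)

-- Let α, β be the roots of X² - xX - y in an extension, so that αβ = -y. By Binet's formula a
-- product of K sequences n ↦ F_{sn+p} is a combination of geometric sequences with ratios
-- α^{s(K-i)} β^{si}, 0 ≤ i ≤ K. By the Gaussian binomial theorem the denominator is (-1)^{s+1}
-- times the monic polynomial with exactly these roots; this is the origin of the Fibopolynomials,
-- the signs and the powers of y. The constant (-1)^{s+1} cancels in the quotient, so only the ratio
-- -q^j of consecutive weights has to be known. Since the m_r may be negative, the recurrence is
-- needed at all integer indices. Quotients are used only through their product with the
-- denominator, followed by cancellation of a nonzero factor.

-- Finite sums over initial segments of the naturals.

module RangeSums {c ℓ : Level} (D : IntegralDomain c ℓ) where
  private module D = IntegralDomain D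
  open D using (Carrier; _≈_; 0#)
  open SemiringSum D.semiring using () renaming (sum to ∑; sum-replicate-zero to ∑-zero)

  ∑≤ : ℕ → (ℕ → Carrier) → Carrier
  ∑≤ n h = ∑ {suc n} (λ i → h (toℕ i))

  ∑≤-cong : ∀ n h h′ → (∀ i → i ≤ n → h i ≈ h′ i) → ∑≤ n h ≈ ∑≤ n h′
  ∑≤-cong n h h′ e = SemiringSum.sum-cong-≋ D.semiring {suc n}
    (λ i → e (toℕ i) (s≤s⁻¹ (Fin.toℕ<n i)))

  ∑≤-distribˡ : ∀ n r h → r D.* ∑≤ n h ≈ ∑≤ n (λ i → r D.* h i)
  ∑≤-distribˡ n r h = SemiringSum.*-distribˡ-sum D.semiring {suc n} r (λ i → h (toℕ i))

  ∑≤-+ : ∀ n h h′ → ∑≤ n (λ i → h i D.+ h′ i) ≈ ∑≤ n h D.+ ∑≤ n h′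
  ∑≤-+ n h h′ = SemiringSum.∑-distrib-+ D.semiring {suc n} (λ i → h (toℕ i)) (λ i → h′ (toℕ i))

  ∑≤-zero : ∀ n {h} → (∀ i → h i ≈ 0#) → ∑≤ n h ≈ 0#
  ∑≤-zero n {h} e = D.trans (∑≤-cong n h (λ _ → 0#) (λ i _ → e i)) (∑-zero (suc n))

  ∑≤-vanishing : ∀ n m h → (∀ i → n ≤ i → h (suc i) ≈ 0#) → ∑≤ (n + m) h ≈ ∑≤ n h
  ∑≤-vanishing zero    zero    h e = D.refl
  ∑≤-vanishing zero    (suc m) h e = D.+-congˡ (∑≤-zero m {λ i → h (suc i)} (λ i → e i z≤n))
  ∑≤-vanishing (suc n) m       h e = D.+-congˡ (∑≤-vanishing n m (λ i → h (suc i)) (λ i n≤i → e (suc i) (s≤s n≤i)))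

  ∑≤-head≈0 : ∀ n h → h 0 ≈ 0# → ∑≤ (suc n) h ≈ ∑≤ n (λ i → h (suc i))
  ∑≤-head≈0 n h e = D.trans (D.+-congʳ e) (D.+-identityˡ _)

-- Homogeneous forms in second order sequences.

-- w plays the role of F_{s·} and q that of (-y)^s.
module _ {c ℓ : Level} (D : IntegralDomain c ℓ) where
  open IntegralDomain D using (Carrier; _≈_; 0#; 1#) renaming (_+_ to _⊕_; _*_ to _⊗_)

  module Forms (w : ℕ → Carrier) (q : Carrier) where
    private module D = IntegralDomain D
    open SemiringExp D.semiring using (_^_)
    open CommutativeMonoidSum D.*-commutativeMonoid using () renaming (sum to ∏)

    Sequence : Set c
    Sequence = ℕ → Carrier

    -- Three terms of a solution of the second order recurrence with characteristic
    -- roots αˢ and βˢ, where q = αˢβˢ, are related in this way.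
    Elementary : Sequence → Set ℓ
    Elementary a = ∀ i j n → w (i + j) ⊗ a (n + i) ≈ w i ⊗ a (n + (i + j)) ⊕ q ^ i ⊗ w j ⊗ a n

    -- The index counts elementary factors, and every summand has the same number of them. An
    -- inductive description lets annihilation be proved constructor by constructor; `resp` is there
    -- because sequences are compared pointwise.
    data Form : ℕ → Sequence → Set (c ⊔ ℓ) where
      one   : Form 0 (λ _ → 1#)
      mul   : ∀ {d a e} → Elementary e → Form d a → Form (suc d) (λ n → e n ⊗ a n)
      add   : ∀ {d a a′} → Form d a → Form d a′ → Form d (λ n → a n ⊕ a′ n)
      scale : ∀ {d a} r → Form d a → Form d (λ n → r ⊗ a n)
      resp  : ∀ {d a a′} → (∀ n → a n ≈ a′ n) → Form d a → Form d a′

    Form-* : ∀ {d d′ a a′} → Form d a → Form d′ a′ → Form (d + d′) (λ n → a n ⊗ a′ n)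
    Form-* one         ψ = resp (λ n → D.sym (D.*-identityˡ _)) ψ
    Form-* (mul e φ)   ψ = resp (λ n → D.sym (D.*-assoc _ _ _)) (mul e (Form-* φ ψ))
    Form-* (add φ φ′)  ψ = resp (λ n → D.sym (D.distribʳ _ _ _)) (add (Form-* φ ψ) (Form-* φ′ ψ))
    Form-* (scale r φ) ψ = resp (λ n → D.sym (D.*-assoc _ _ _)) (scale r (Form-* φ ψ))
    Form-* (resp p φ)  ψ = resp (λ n → D.*-congʳ (p n)) (Form-* φ ψ)

    Form-^ : ∀ {d a} k → Form d a → Form (k * d) (λ n → a n ^ k)
    Form-^ zero    φ = one
    Form-^ (suc k) φ = Form-* φ (Form-^ k φ)

    Form-∏ : ∀ {l} (d : Fin l → ℕ) (a : Fin l → Sequence) → (∀ r → Form (d r) (a r)) →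
             Form (sum +-0-commutativeMonoid d) (λ n → ∏ (λ r → a r n))
    Form-∏ {zero}  d a φ = one
    Form-∏ {suc l} d a φ = Form-* (φ zero) (Form-∏ (λ r → d (suc r)) (λ r → a (suc r)) (λ r → φ (suc r)))

-- Recurrences with Fibopolynomial coefficients.

-- g j is the sign and power of y that multiply the j-th Fibopolynomial; u is -1.
module _ {c ℓ : Level} (D : IntegralDomain c ℓ) where
  open IntegralDomain D using (Carrier; _≈_; 0#; 1#) renaming (_+_ to _⊕_; _*_ to _⊗_)
  open SemiringExp (IntegralDomain.semiring D) using (_^_)

  module Annihilator
    (w : ℕ → Carrier) (w-zero : w 0 ≈ 0#) (w≉0 : ∀ n → ¬ (w (suc n) ≈ 0#))
    (b : ℕ → ℕ → Carrier)
    (b-zero : ∀ n → b n 0 ≈ 1#)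
    (b-vanishing : ∀ n j → n ≤ j → b n (suc j) ≈ 0#)
    (b-lower : ∀ n j → b (suc n) j ⊗ w (suc n ∸ j) ≈ w (suc n) ⊗ b n j)
    (b-diagonal : ∀ n j → b (suc n) (suc j) ⊗ w (suc j) ≈ w (suc n) ⊗ b n j)
    (q u : Carrier) (1+u≈0 : 1# ⊕ u ≈ 0#)
    (g : ℕ → Carrier) (g-suc : ∀ j → g (suc j) ≈ u ⊗ q ^ j ⊗ g j)
    where
    private module D = IntegralDomain D
    open DomainProperties D using (*-cancelˡ)
    open SetoidReasoning D.setoid
    open SemiringSolver D.commutativeSemiring using (solve; _:=_; _:+_; _:*_; con)
    open RangeSums D
    open Forms D w q

    coefficient : ℕ → ℕ → Carrier
    coefficient n j = g j ⊗ b n j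

    coefficient-vanishing : ∀ n j → n ≤ j → coefficient n (suc j) ≈ 0#
    coefficient-vanishing n j n≤j = D.trans (D.*-congˡ (b-vanishing n j n≤j)) (D.zeroʳ (g (suc j)))

    summand : ℕ → Sequence → ℕ → ℕ → Carrier
    summand d a n j = coefficient d j ⊗ a (n + (d ∸ j))

    -- The linear recurrence with characteristic polynomial Σ_j `coefficient d j` X^{d-j}.
    Annihilated : ℕ → Sequence → Set ℓ
    Annihilated d a = ∀ n → ∑≤ d (summand d a n) ≈ 0#

    annihilated-one : Annihilated 1 (λ _ → 1#)
    annihilated-one n = begin
      g 0 ⊗ b 1 0 ⊗ 1# ⊕ (g 1 ⊗ b 1 1 ⊗ 1# ⊕ 0#)
        ≈⟨ D.+-cong (D.*-congʳ (D.*-congˡ (b-zero 1)))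
             (D.+-congʳ (D.*-congʳ (D.*-cong (g-suc 0) b₁₁≈1))) ⟩
      g 0 ⊗ 1# ⊗ 1# ⊕ (u ⊗ 1# ⊗ g 0 ⊗ 1# ⊗ 1# ⊕ 0#)
        ≈⟨ solve 2 (λ g u → g :* con 1 :* con 1 :+ (u :* con 1 :* g :* con 1 :* con 1 :+ con 0)
             := (con 1 :+ u) :* g) D.refl (g 0) u ⟩
      (1# ⊕ u) ⊗ g 0    ≈⟨ D.*-congʳ 1+u≈0 ⟩
      0# ⊗ g 0          ≈⟨ D.zeroˡ (g 0) ⟩
      0#                ∎
      where
      b₁₁≈1 : b 1 1 ≈ 1#
      b₁₁≈1 = *-cancelˡ (w≉0 0) (begin
        w 1 ⊗ b 1 1   ≈⟨ D.*-comm _ _ ⟩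
        b 1 1 ⊗ w 1   ≈⟨ b-diagonal 0 0 ⟩
        w 1 ⊗ b 0 0   ≈⟨ D.*-congˡ (b-zero 0) ⟩
        w 1 ⊗ 1#      ∎)

    -- `Elementary e` is applied to indices with sum `suc d`, so the factors `e (n + suc d)` and
    -- `e n` that it produces do not depend on `j` and leave the sums. What remains is the
    -- hypothesis on `a`, once started at `suc n` and once at `n`.
    annihilated-mul : ∀ {d a e} → Elementary e → Annihilated d a →
                      Annihilated (suc d) (λ n → e n ⊗ a n)
    annihilated-mul {d} {a} {e} elementary ann n = *-cancelˡ (w≉0 d) (begin
      w (suc d) ⊗ ∑≤ (suc d) term
        ≈⟨ ∑≤-distribˡ (suc d) (w (suc d)) term ⟩
      ∑≤ (suc d) (λ j → w (suc d) ⊗ term j)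
        ≈⟨ ∑≤-cong (suc d) (λ j → w (suc d) ⊗ term j) (λ j → upper j ⊕ lower j) split ⟩
      ∑≤ (suc d) (λ j → upper j ⊕ lower j)
        ≈⟨ ∑≤-+ (suc d) upper lower ⟩
      ∑≤ (suc d) upper ⊕ ∑≤ (suc d) lower
        ≈⟨ D.+-cong upper≈0 lower≈0 ⟩
      0# ⊕ 0#
        ≈⟨ D.+-identityˡ 0# ⟩
      0#
        ≈⟨ D.zeroʳ (w (suc d)) ⟨
      w (suc d) ⊗ 0# ∎)
      where
      term upper lower : ℕ → Carrier
      term j = coefficient (suc d) j ⊗ (e (n + (suc d ∸ j)) ⊗ a (n + (suc d ∸ j)))
      upper j = (w (suc d) ⊗ e (n + suc d)) ⊗ (coefficient d j ⊗ a (n + (suc d ∸ j)))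
      lower j = g j ⊗ (b (suc d) j ⊗ w j) ⊗ q ^ (suc d ∸ j) ⊗ a (n + (suc d ∸ j)) ⊗ e n

      elementary′ : ∀ {m} i j → i + j ≡ m → w m ⊗ e (n + i) ≈ w i ⊗ e (n + m) ⊕ q ^ i ⊗ w j ⊗ e n
      elementary′ i j ≡.refl = elementary i j n

      split : ∀ j → j ≤ suc d → w (suc d) ⊗ term j ≈ upper j ⊕ lower j
      split j j≤ = begin
        W ⊗ (G ⊗ B ⊗ (E ⊗ A))
          ≈⟨ solve 5 (λ W G B E A → W :* (G :* B :* (E :* A)) := (G :* B :* A) :* (W :* E)) D.refl W G B E A ⟩
        (G ⊗ B ⊗ A) ⊗ (W ⊗ E)
          ≈⟨ D.*-congˡ (elementary′ (suc d ∸ j) j (ℕ.m∸n+n≡m j≤)) ⟩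
        (G ⊗ B ⊗ A) ⊗ (W′ ⊗ E₁ ⊕ Q ⊗ V ⊗ E₀)
          ≈⟨ solve 8 (λ G B A W′ E₁ Q V E₀ → (G :* B :* A) :* (W′ :* E₁ :+ Q :* V :* E₀)
               := (B :* W′) :* (E₁ :* (G :* A)) :+ G :* (B :* V) :* Q :* A :* E₀) D.refl G B A W′ E₁ Q V E₀ ⟩
        (B ⊗ W′) ⊗ (E₁ ⊗ (G ⊗ A)) ⊕ lower j
          ≈⟨ D.+-congʳ (D.*-congʳ (b-lower d j)) ⟩
        (W ⊗ b d j) ⊗ (E₁ ⊗ (G ⊗ A)) ⊕ lower j
          ≈⟨ D.+-congʳ (solve 5 (λ W B E₁ G A → (W :* B) :* (E₁ :* (G :* A))
               := (W :* E₁) :* ((G :* B) :* A)) D.refl W (b d j) E₁ G A) ⟩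
        upper j ⊕ lower j ∎
        where
        W = w (suc d)
        W′ = w (suc d ∸ j)
        V = w j
        G = g j
        B = b (suc d) j
        E = e (n + (suc d ∸ j))
        E₀ = e n
        E₁ = e (n + suc d)
        A = a (n + (suc d ∸ j))
        Q = q ^ (suc d ∸ j)

      upper≈0 : ∑≤ (suc d) upper ≈ 0#
      upper≈0 = begin
        ∑≤ (suc d) upper
          ≈⟨ ∑≤-distribˡ (suc d) _ inner ⟨
        (w (suc d) ⊗ e (n + suc d)) ⊗ ∑≤ (suc d) inner
          ≈⟨ D.*-congˡ (begin
            -- The term `j = suc d` has coefficient zero and must be dropped first: only for `j ≤ d`
            -- does `n + (suc d ∸ j)` equal `suc n + (d ∸ j)`.
            ∑≤ (suc d) inner       ≡⟨ ≡.cong (λ m → ∑≤ m inner) (ℕ.+-comm 1 d) ⟩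
            ∑≤ (d + 1) inner       ≈⟨ ∑≤-vanishing d 1 inner (λ i d≤i → D.trans
                                        (D.*-congʳ (coefficient-vanishing d i d≤i)) (D.zeroˡ _)) ⟩
            ∑≤ d inner             ≈⟨ ∑≤-cong d inner (summand d a (suc n))
                                        (λ j j≤d → D.*-congˡ (D.reflexive (≡.cong a (index j j≤d)))) ⟩
            ∑≤ d (summand d a (suc n))
                                   ≈⟨ ann (suc n) ⟩
            0#                     ∎) ⟩
        (w (suc d) ⊗ e (n + suc d)) ⊗ 0#
          ≈⟨ D.zeroʳ _ ⟩
        0# ∎
        where
        inner : ℕ → Carrier
        inner j = coefficient d j ⊗ a (n + (suc d ∸ j))

        index : ∀ j → j ≤ d → n + (suc d ∸ j) ≡ suc n + (d ∸ j)
        index j j≤d = ≡.trans (≡.cong (λ h → n + h) (ℕ.+-∸-assoc 1 j≤d)) (ℕ.+-suc n (d ∸ j))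

      lower≈0 : ∑≤ (suc d) lower ≈ 0#
      lower≈0 = begin
        ∑≤ (suc d) lower
          ≈⟨ ∑≤-head≈0 d lower (D.trans (D.*-congʳ (D.*-congʳ (D.*-congʳ (D.*-congˡ
               (D.trans (D.*-congˡ w-zero) (D.zeroʳ (b (suc d) 0)))))))
               (solve 4 (λ G Q A E → G :* con 0 :* Q :* A :* E := con 0) D.refl
                 (g 0) (q ^ suc d) (a (n + suc d)) (e n))) ⟩
        ∑≤ d (λ j → lower (suc j))
          ≈⟨ ∑≤-cong d (λ j → lower (suc j)) (λ j → (w (suc d) ⊗ u ⊗ q ^ d ⊗ e n) ⊗ summand d a n j) shift ⟩
        ∑≤ d (λ j → (w (suc d) ⊗ u ⊗ q ^ d ⊗ e n) ⊗ summand d a n j)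
          ≈⟨ ∑≤-distribˡ d _ (summand d a n) ⟨
        (w (suc d) ⊗ u ⊗ q ^ d ⊗ e n) ⊗ ∑≤ d (summand d a n)
          ≈⟨ D.*-congˡ (ann n) ⟩
        (w (suc d) ⊗ u ⊗ q ^ d ⊗ e n) ⊗ 0#
          ≈⟨ D.zeroʳ _ ⟩
        0# ∎
        where
        open SemiringExp D.semiring using (^-homo-*; ^-congʳ)

        -- The power `q ^ (d ∸ j)` from the elementary relation meets `q ^ j` from `g-suc`. Their
        -- product `q ^ d` is free of `j`, which is what dictates the ratio of consecutive weights.
        shift : ∀ j → j ≤ d →
                lower (suc j) ≈ (w (suc d) ⊗ u ⊗ q ^ d ⊗ e n) ⊗ (coefficient d j ⊗ a (n + (d ∸ j)))
        shift j j≤d = begin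
          g (suc j) ⊗ (b (suc d) (suc j) ⊗ w (suc j)) ⊗ Q ⊗ A ⊗ E
            ≈⟨ D.*-congʳ (D.*-congʳ (D.*-congʳ (D.*-cong (g-suc j) (b-diagonal d j)))) ⟩
          (u ⊗ R ⊗ G) ⊗ (W ⊗ B) ⊗ Q ⊗ A ⊗ E
            ≈⟨ solve 8 (λ u R G W B Q A E → (u :* R :* G) :* (W :* B) :* Q :* A :* E
                 := (W :* u :* (Q :* R) :* E) :* ((G :* B) :* A)) D.refl u R G W B Q A E ⟩
          (W ⊗ u ⊗ (Q ⊗ R) ⊗ E) ⊗ ((G ⊗ B) ⊗ A)
            ≈⟨ D.*-congʳ (D.*-congʳ (D.*-congˡ (D.trans (D.sym (^-homo-* q (d ∸ j) j))
                 (^-congʳ q (ℕ.m∸n+n≡m j≤d))))) ⟩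
          (W ⊗ u ⊗ q ^ d ⊗ E) ⊗ ((G ⊗ B) ⊗ A) ∎
          where
          W = w (suc d)
          B = b d j
          G = g j
          R = q ^ j
          Q = q ^ (d ∸ j)
          A = a (n + (d ∸ j))
          E = e n

    annihilated-add : ∀ {d a a′} → Annihilated d a → Annihilated d a′ →
                      Annihilated d (λ n → a n ⊕ a′ n)
    annihilated-add {d} {a} {a′} ann ann′ n = begin
      ∑≤ d (summand d (λ n → a n ⊕ a′ n) n)
        ≈⟨ ∑≤-cong d (summand d (λ n → a n ⊕ a′ n) n) (λ j → summand d a n j ⊕ summand d a′ n j)
             (λ j _ → D.distribˡ (coefficient d j) (a (n + (d ∸ j))) (a′ (n + (d ∸ j)))) ⟩
      ∑≤ d (λ j → summand d a n j ⊕ summand d a′ n j)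
        ≈⟨ ∑≤-+ d (summand d a n) (summand d a′ n) ⟩
      ∑≤ d (summand d a n) ⊕ ∑≤ d (summand d a′ n)
        ≈⟨ D.+-cong (ann n) (ann′ n) ⟩
      0# ⊕ 0#
        ≈⟨ D.+-identityˡ 0# ⟩
      0# ∎

    annihilated-scale : ∀ {d a} r → Annihilated d a → Annihilated d (λ n → r ⊗ a n)
    annihilated-scale {d} {a} r ann n = begin
      ∑≤ d (summand d (λ n → r ⊗ a n) n)
        ≈⟨ ∑≤-cong d (summand d (λ n → r ⊗ a n) n) (λ j → r ⊗ summand d a n j)
             (λ j _ → solve 3 (λ c r a → c :* (r :* a) := r :* (c :* a)) D.refl
               (coefficient d j) r (a (n + (d ∸ j)))) ⟩
      ∑≤ d (λ j → r ⊗ summand d a n j)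
        ≈⟨ ∑≤-distribˡ d r (summand d a n) ⟨
      r ⊗ ∑≤ d (summand d a n)
        ≈⟨ D.*-congˡ (ann n) ⟩
      r ⊗ 0#
        ≈⟨ D.zeroʳ r ⟩
      0# ∎

    annihilated-resp : ∀ {d a a′} → (∀ n → a n ≈ a′ n) → Annihilated d a → Annihilated d a′
    annihilated-resp {d} {a} {a′} p ann n = D.trans
      (∑≤-cong d (summand d a′ n) (summand d a n) (λ j _ → D.*-congˡ (D.sym (p (n + (d ∸ j))))))
      (ann n)

    annihilated : ∀ {d a} → Form d a → Annihilated (suc d) a
    annihilated one                           = annihilated-one
    annihilated (mul {a = a} {e} ε φ)         = annihilated-mul {a = a} {e} ε (annihilated φ)
    annihilated (add {a = a} {a′} φ φ′)       = annihilated-add {a = a} {a′} (annihilated φ) (annihilated φ′)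
    annihilated (scale {a = a} r φ)           = annihilated-scale {a = a} r (annihilated φ)
    annihilated (resp {a = a} {a′} p φ)       = annihilated-resp {a = a} {a′} p (annihilated φ)

    -- Beyond degree `d` the convolution contains the whole recurrence, started at `i ∸ d`; its
    -- remaining terms carry coefficients past the order `suc d`, which vanish.
    product-vanishing : ∀ {d a} → Form d a → ∀ i → d ≤ i →
                        PowerSeries._*_ D (coefficient (suc d)) a (suc i) ≈ 0#
    product-vanishing {d} {a} φ i d≤i = begin
      ∑≤ (suc i) (convolution (suc i))
        ≡⟨ ≡.cong (λ m → ∑≤ (suc m) (convolution (suc m))) (≡.sym (ℕ.m+[n∸m]≡n d≤i)) ⟩
      ∑≤ (suc d + n) (convolution (suc d + n))
        ≈⟨ ∑≤-vanishing (suc d) n (convolution (suc d + n)) (λ j 1+d≤j → D.trans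
             (D.*-congʳ (coefficient-vanishing (suc d) j 1+d≤j)) (D.zeroˡ _)) ⟩
      ∑≤ (suc d) (convolution (suc d + n))
        ≈⟨ ∑≤-cong (suc d) (convolution (suc d + n)) (summand (suc d) a n)
             (λ j j≤ → D.*-congˡ (D.reflexive (≡.cong a
               (≡.trans (≡.cong (_∸ j) (ℕ.+-comm (suc d) n)) (ℕ.+-∸-assoc n j≤))))) ⟩
      ∑≤ (suc d) (summand (suc d) a n)
        ≈⟨ annihilated φ n ⟩
      0# ∎
      where
      n = i ∸ d

      convolution : ℕ → ℕ → Carrier
      convolution m j = coefficient (suc d) j ⊗ a (m ∸ j)

-- Addition formula, Cassini's and d'Ocagne's identities.

module _ {c ℓ : Level} (R : CommutativeSemiring c ℓ) where
  open CommutativeSemiring R using (Carrier; _≈_; 0#; 1#) renaming (_+_ to _⊕_; _*_ to _⊗_)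

  -- Here `q` is -y, given by an equation without subtraction so that the identities live in a
  -- semiring and the semiring solver applies.
  module SecondOrder (x y q : Carrier) (q+y≈0 : q ⊕ y ≈ 0#) where
    private module R = CommutativeSemiring R
    open SemiringExp R.semiring using (_^_)
    open SetoidReasoning R.setoid
    open SemiringSolver R using (solve; _:=_; _:+_; _:*_; con)

    Solution : (ℕ → Carrier) → Set ℓ
    Solution h = ∀ n → h (suc (suc n)) ≈ x ⊗ h (suc n) ⊕ y ⊗ h n

    solution-unique : ∀ {h h′} → Solution h → Solution h′ → h 0 ≈ h′ 0 → h 1 ≈ h′ 1 → ∀ n → h n ≈ h′ n
    solution-unique {h} {h′} r r′ e₀ e₁ n = proj₁ (both n)
      where
      both : ∀ n → h n ≈ h′ n × h (suc n) ≈ h′ (suc n)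
      both zero    = e₀ , e₁
      both (suc n) = let eₙ , eₙ₊₁ = both n in
        eₙ₊₁ , R.trans (r n) (R.trans (R.+-cong (R.*-congˡ eₙ₊₁) (R.*-congˡ eₙ)) (R.sym (r′ n)))

    solution-shift : ∀ {h} → Solution h → ∀ m → Solution (λ n → h (m + n))
    solution-shift {h} r m n = begin
      h (m + suc (suc n))                       ≡⟨ ≡.cong h (ℕ.+-suc m (suc n)) ⟩
      h (suc (m + suc n))                       ≡⟨ ≡.cong (λ k → h (suc k)) (ℕ.+-suc m n) ⟩
      h (suc (suc (m + n)))                     ≈⟨ r (m + n) ⟩
      x ⊗ h (suc (m + n)) ⊕ y ⊗ h (m + n)       ≡⟨ ≡.cong (λ k → x ⊗ h k ⊕ y ⊗ h (m + n)) (ℕ.+-suc m n) ⟨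
      x ⊗ h (m + suc n) ⊕ y ⊗ h (m + n)         ∎

    solution-linear : ∀ {h h′} r r′ → Solution h → Solution h′ → Solution (λ n → r ⊗ h n ⊕ r′ ⊗ h′ n)
    solution-linear {h} {h′} r r′ p p′ n = begin
      r ⊗ h (suc (suc n)) ⊕ r′ ⊗ h′ (suc (suc n))
        ≈⟨ R.+-cong (R.*-congˡ (p n)) (R.*-congˡ (p′ n)) ⟩
      r ⊗ (x ⊗ h (suc n) ⊕ y ⊗ h n) ⊕ r′ ⊗ (x ⊗ h′ (suc n) ⊕ y ⊗ h′ n)
        ≈⟨ solve 8 (λ r r′ x y h₁ h₀ h₁′ h₀′ →
             r :* (x :* h₁ :+ y :* h₀) :+ r′ :* (x :* h₁′ :+ y :* h₀′)
             := x :* (r :* h₁ :+ r′ :* h₁′) :+ y :* (r :* h₀ :+ r′ :* h₀′)) R.refl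
             r r′ x y (h (suc n)) (h n) (h′ (suc n)) (h′ n) ⟩
      x ⊗ (r ⊗ h (suc n) ⊕ r′ ⊗ h′ (suc n)) ⊕ y ⊗ (r ⊗ h n ⊕ r′ ⊗ h′ n) ∎

    module _ {f : ℕ → Carrier} (f₀≈0 : f 0 ≈ 0#) (f₁≈1 : f 1 ≈ 1#) (f-sol : Solution f)
             {h : ℕ → Carrier} (h-sol : Solution h) where

      -- Both sides are solutions in `n`, so two initial values decide.
      addition : ∀ n → h (suc n) ≈ f (suc n) ⊗ h 1 ⊕ y ⊗ f n ⊗ h 0
      addition n = begin
        h (suc n)
          ≈⟨ solution-unique (solution-shift h-sol 1)
               (solution-linear (h 1) (y ⊗ h 0) (solution-shift f-sol 1) f-sol) at-0 at-1 n ⟩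
        h 1 ⊗ f (suc n) ⊕ y ⊗ h 0 ⊗ f n
          ≈⟨ solve 5 (λ h₁ f₁ y h₀ f₀ → h₁ :* f₁ :+ y :* h₀ :* f₀ := f₁ :* h₁ :+ y :* f₀ :* h₀) R.refl
               (h 1) (f (suc n)) y (h 0) (f n) ⟩
        f (suc n) ⊗ h 1 ⊕ y ⊗ f n ⊗ h 0 ∎
        where
        at-0 : h 1 ≈ h 1 ⊗ f 1 ⊕ y ⊗ h 0 ⊗ f 0
        at-0 = R.sym (begin
          h 1 ⊗ f 1 ⊕ y ⊗ h 0 ⊗ f 0
            ≈⟨ R.+-cong (R.*-congˡ f₁≈1) (R.*-congˡ f₀≈0) ⟩
          h 1 ⊗ 1# ⊕ y ⊗ h 0 ⊗ 0#
            ≈⟨ solve 3 (λ h₁ y h₀ → h₁ :* con 1 :+ y :* h₀ :* con 0 := h₁) R.refl (h 1) y (h 0) ⟩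
          h 1 ∎)

        at-1 : h 2 ≈ h 1 ⊗ f 2 ⊕ y ⊗ h 0 ⊗ f 1
        at-1 = R.sym (begin
          h 1 ⊗ f 2 ⊕ y ⊗ h 0 ⊗ f 1
            ≈⟨ R.+-congʳ (R.*-congˡ (f-sol 0)) ⟩
          h 1 ⊗ (x ⊗ f 1 ⊕ y ⊗ f 0) ⊕ y ⊗ h 0 ⊗ f 1
            ≈⟨ R.+-cong (R.*-congˡ (R.+-cong (R.*-congˡ f₁≈1) (R.*-congˡ f₀≈0))) (R.*-congˡ f₁≈1) ⟩
          h 1 ⊗ (x ⊗ 1# ⊕ y ⊗ 0#) ⊕ y ⊗ h 0 ⊗ 1#
            ≈⟨ solve 4 (λ h₁ x y h₀ → h₁ :* (x :* con 1 :+ y :* con 0) :+ y :* h₀ :* con 1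
                 := x :* h₁ :+ y :* h₀) R.refl (h 1) x y (h 0) ⟩
          x ⊗ h 1 ⊕ y ⊗ h 0
            ≈⟨ h-sol 0 ⟨
          h 2 ∎)

      cassini : ∀ n → f (suc n) ⊗ h n ≈ f n ⊗ h (suc n) ⊕ q ^ n ⊗ h 0
      cassini zero = begin
        f 1 ⊗ h 0
          ≈⟨ R.*-congʳ f₁≈1 ⟩
        1# ⊗ h 0
          ≈⟨ R.trans (R.+-congʳ (R.trans (R.*-congʳ f₀≈0) (R.zeroˡ (h 1)))) (R.+-identityˡ _) ⟨
        f 0 ⊗ h 1 ⊕ 1# ⊗ h 0 ∎
      cassini (suc n) = begin
        f (suc (suc n)) ⊗ h₁
          ≈⟨ R.*-congʳ (f-sol n) ⟩
        (x ⊗ f₁ ⊕ y ⊗ f₀) ⊗ h₁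
          ≈⟨ R.+-identityʳ _ ⟨
        (x ⊗ f₁ ⊕ y ⊗ f₀) ⊗ h₁ ⊕ 0#
          -- Zero is added as a multiple of `q ⊕ y`: its `y` part completes the right-hand side of
          -- the induction hypothesis, its `q` part is the new last term.
          ≈⟨ R.+-congˡ (R.trans (R.*-congʳ q+y≈0) (R.zeroˡ (qⁿ ⊗ h 0))) ⟨
        (x ⊗ f₁ ⊕ y ⊗ f₀) ⊗ h₁ ⊕ (q ⊕ y) ⊗ (qⁿ ⊗ h 0)
          ≈⟨ solve 8 (λ x f₁ y f₀ h₁ q qⁿ h → (x :* f₁ :+ y :* f₀) :* h₁ :+ (q :+ y) :* (qⁿ :* h)
               := x :* f₁ :* h₁ :+ y :* (f₀ :* h₁ :+ qⁿ :* h) :+ q :* qⁿ :* h) R.refl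
               x f₁ y f₀ h₁ q qⁿ (h 0) ⟩
        x ⊗ f₁ ⊗ h₁ ⊕ y ⊗ (f₀ ⊗ h₁ ⊕ qⁿ ⊗ h 0) ⊕ q ⊗ qⁿ ⊗ h 0
          ≈⟨ R.+-congʳ (R.+-congˡ (R.*-congˡ (cassini n))) ⟨
        x ⊗ f₁ ⊗ h₁ ⊕ y ⊗ (f₁ ⊗ h n) ⊕ q ⊗ qⁿ ⊗ h 0
          ≈⟨ R.+-congʳ (solve 5 (λ x f₁ h₁ y h₀ → x :* f₁ :* h₁ :+ y :* (f₁ :* h₀)
               := f₁ :* (x :* h₁ :+ y :* h₀)) R.refl x f₁ h₁ y (h n)) ⟩
        f₁ ⊗ (x ⊗ h₁ ⊕ y ⊗ h n) ⊕ q ⊗ qⁿ ⊗ h 0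
          ≈⟨ R.+-congʳ (R.*-congˡ (h-sol n)) ⟨
        f₁ ⊗ h (suc (suc n)) ⊕ q ⊗ qⁿ ⊗ h 0 ∎
        where
        f₀ = f n
        f₁ = f (suc n)
        h₁ = h (suc n)
        qⁿ = q ^ n

      -- As functions of m, both sides are solutions, so m = 0 and m = 1 suffice.
      d'Ocagne : ∀ n m → f (n + m) ⊗ h n ≈ f n ⊗ h (n + m) ⊕ q ^ n ⊗ f m ⊗ h 0
      d'Ocagne n m = begin
        f (n + m) ⊗ h n
          -- The zero summand gives the left side the two-term shape of `solution-linear`.
          ≈⟨ solve 2 (λ f h → f :* h := h :* f :+ con 0 :* f) R.refl (f (n + m)) (h n) ⟩
        h n ⊗ f (n + m) ⊕ 0# ⊗ f (n + m)
          ≈⟨ solution-unique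
               (solution-linear (h n) 0# (solution-shift f-sol n) (solution-shift f-sol n))
               (solution-linear (f n) (q ^ n ⊗ h 0) (solution-shift h-sol n) f-sol) at-0 at-1 m ⟩
        f n ⊗ h (n + m) ⊕ q ^ n ⊗ h 0 ⊗ f m
          ≈⟨ R.+-congˡ (solve 3 (λ a b c → a :* b :* c := a :* c :* b) R.refl (q ^ n) (h 0) (f m)) ⟩
        f n ⊗ h (n + m) ⊕ q ^ n ⊗ f m ⊗ h 0 ∎
        where
        at-0 : h n ⊗ f (n + 0) ⊕ 0# ⊗ f (n + 0) ≈ f n ⊗ h (n + 0) ⊕ q ^ n ⊗ h 0 ⊗ f 0
        at-0 rewrite ℕ.+-identityʳ n = begin
          h n ⊗ f n ⊕ 0# ⊗ f n
            ≈⟨ solve 3 (λ f h k → h :* f :+ con 0 :* f := f :* h :+ k :* con 0) R.refl (f n) (h n) (q ^ n ⊗ h 0) ⟩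
          f n ⊗ h n ⊕ q ^ n ⊗ h 0 ⊗ 0#
            ≈⟨ R.+-congˡ (R.*-congˡ f₀≈0) ⟨
          f n ⊗ h n ⊕ q ^ n ⊗ h 0 ⊗ f 0 ∎

        at-1 : h n ⊗ f (n + 1) ⊕ 0# ⊗ f (n + 1) ≈ f n ⊗ h (n + 1) ⊕ q ^ n ⊗ h 0 ⊗ f 1
        at-1 rewrite ℕ.+-comm n 1 = begin
          h n ⊗ f (suc n) ⊕ 0# ⊗ f (suc n)
            ≈⟨ solve 2 (λ f h → h :* f :+ con 0 :* f := f :* h) R.refl (f (suc n)) (h n) ⟩
          f (suc n) ⊗ h n
            ≈⟨ cassini n ⟩
          f n ⊗ h (suc n) ⊕ q ^ n ⊗ h 0
            ≈⟨ R.+-congˡ (R.trans (R.*-congˡ f₁≈1) (R.*-identityʳ _)) ⟨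
          f n ⊗ h (suc n) ⊕ q ^ n ⊗ h 0 ⊗ f 1 ∎

-- The embedding of a domain into its fractions.

module FractionProperties {c ℓ : Level} (D : IntegralDomain c ℓ) where
  private
    module D = IntegralDomain D
    module Q = IntegralDomain (Fractions.integralDomain D)
  open Fractions D using (ι; fraction; cross; _÷_[_])
  open SemiringSolver D.commutativeSemiring using (solve; _:=_; _:+_; _:*_; con)

  ι-cong : ∀ {a b} → a D.≈ b → ι a Q.≈ ι b
  ι-cong a≈b = cross (D.*-congʳ a≈b)

  ι-+ : ∀ a b → ι (a D.+ b) Q.≈ ι a Q.+ ι b
  ι-+ a b = cross (solve 2 (λ a b → (a :+ b) :* (con 1 :* con 1)
    := (a :* con 1 :+ b :* con 1) :* con 1) D.refl a b)

  ι-* : ∀ a b → ι (a D.* b) Q.≈ ι a Q.* ι b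
  ι-* a b = cross (D.*-congˡ (D.*-identityˡ D.1#))

  ι-linear : ∀ a b d e → ι (a D.* b D.+ d D.* e) Q.≈ ι a Q.* ι b Q.+ ι d Q.* ι e
  ι-linear a b d e = cross (solve 4 (λ a b d e →
    (a :* b :+ d :* e) :* ((con 1 :* con 1) :* (con 1 :* con 1))
    := ((a :* b) :* (con 1 :* con 1) :+ (d :* e) :* (con 1 :* con 1)) :* con 1) D.refl a b d e)

  ÷-* : ∀ p q (q≉0 : ¬ (q Q.≈ Q.0#)) → (p ÷ q [ q≉0 ]) Q.* q Q.≈ p
  ÷-* (fraction a b _) (fraction d e _) q≉0 = cross
    (solve 4 (λ a b d e → ((a :* e) :* d) :* b := a :* ((b :* d) :* e)) D.refl a b d e)

  -÷-* : ∀ p q (q≉0 : ¬ (q Q.≈ Q.0#)) → (Q.- (p ÷ q [ q≉0 ])) Q.* q Q.+ p Q.≈ Q.0#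
  -÷-* p q q≉0 = Q.trans
    (Q.+-cong {Q.- r Q.* q} {Q.- (r Q.* q)} {p} {r Q.* q}
      (Q.sym (-‿distribˡ-* r q)) (Q.sym (÷-* p q q≉0)))
    (Q.-‿inverseˡ (r Q.* q))
    where
    open RingProperties Q.ring using (-‿distribˡ-*)
    r = p ÷ q [ q≉0 ]

-- From series in z⁻¹ to polynomials in z.

module _ {c ℓ : Level} (L : IntegralDomain c ℓ) where
  open IntegralDomain L using (Carrier; _≈_; 0#; 1#) renaming (_+_ to _⊕_; _*_ to _⊗_)

  module InverseVariable (z w : Carrier) (z*w≈1 : z ⊗ w ≈ 1#) where
    private module L = IntegralDomain L
    open SemiringExp L.semiring using (_^_)
    open RangeSums L
    open SetoidReasoning L.setoid
    open SemiringSolver L.commutativeSemiring using (solve; _:=_; _:+_; _:*_)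

    -- Horner's scheme: `t i` stands for the tail Σ_{j ≥ i} a_j w^{j-i}, and `t n ≈ a n` says that
    -- the series stops at degree `n`. Each step trades one `w` for one power of `z`.
    horner : ∀ n (a t : ℕ → Carrier) → (∀ i → t i ≈ a i ⊕ w ⊗ t (suc i)) → t n ≈ a n →
             ∑≤ n (λ i → a i ⊗ z ^ (n ∸ i)) ≈ z ^ n ⊗ t 0
    horner zero a t _ t≈a = begin
      a 0 ⊗ 1# ⊕ 0#   ≈⟨ L.trans (L.+-identityʳ _) (L.*-comm (a 0) 1#) ⟩
      1# ⊗ a 0        ≈⟨ L.*-congˡ t≈a ⟨
      1# ⊗ t 0        ∎
    horner (suc n) a t step t≈a = begin
      a 0 ⊗ (z ⊗ z ^ n) ⊕ ∑≤ n (λ i → a (suc i) ⊗ z ^ (n ∸ i))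
        ≈⟨ L.+-congˡ (horner n (λ i → a (suc i)) (λ i → t (suc i)) (λ i → step (suc i)) t≈a) ⟩
      a 0 ⊗ (z ⊗ z ^ n) ⊕ z ^ n ⊗ t 1
        ≈⟨ L.+-congˡ (L.*-congʳ (L.*-identityʳ (z ^ n))) ⟨
      a 0 ⊗ (z ⊗ z ^ n) ⊕ z ^ n ⊗ 1# ⊗ t 1
        ≈⟨ L.+-congˡ (L.*-congʳ (L.*-congˡ z*w≈1)) ⟨
      a 0 ⊗ (z ⊗ z ^ n) ⊕ z ^ n ⊗ (z ⊗ w) ⊗ t 1
        ≈⟨ solve 5 (λ a₀ z zⁿ w t → a₀ :* (z :* zⁿ) :+ zⁿ :* (z :* w) :* t
             := (z :* zⁿ) :* (a₀ :+ w :* t)) L.refl (a 0) z (z ^ n) w (t 1) ⟩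
      z ^ suc n ⊗ (a 0 ⊕ w ⊗ t 1)
        ≈⟨ L.*-congˡ (step 0) ⟨
      z ^ suc n ⊗ t 0 ∎

    z≉0 : ¬ (z ≈ 0#)
    z≉0 z≈0 = L.1≉0 (L.trans (L.sym z*w≈1) (L.trans (L.*-congʳ z≈0) (L.zeroˡ w)))

    ∑≤-double : ∀ n (e : ℕ → ℕ → Carrier) (h : ℕ → Carrier) → (∀ i → h i ≈ ∑≤ i (e i)) →
                ∑≤ n (λ i → ∑≤ i (λ j → e i j ⊗ z ^ (n ∸ i))) ≈ ∑≤ n (λ i → h i ⊗ z ^ (n ∸ i))
    ∑≤-double n e h h≈ = ∑≤-cong n _ (λ i → h i ⊗ z ^ (n ∸ i)) (λ i _ → L.sym (L.trans
      (L.*-congʳ (h≈ i)) (SemiringSum.*-distribʳ-sum L.semiring {suc i} (z ^ (n ∸ i)) (λ j → e i (toℕ j)))))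

    nonzero : ∀ n {p den} → ¬ (p ≈ 0#) → den ≈ z ^ n ⊗ p → ¬ (den ≈ 0#)
    nonzero n p≉0 den≈ den≈0 =
      L.*-≉0 (DomainProperties.^-≉0 L n z≉0) p≉0 (L.trans (L.sym den≈) den≈0)

    -- The isolated factor z of the theorem comes from the degrees: clearing negative powers costs
    -- `z ^ suc n` in the denominator but only `z ^ n` in the numerator. The quotient `r` is known
    -- only by `r ⊗ den ≈ num`.
    quotient : ∀ n {p a num den r} → ¬ (den ≈ 0#) → den ≈ z ^ suc n ⊗ p → num ≈ z ^ n ⊗ (p ⊗ a) →
               r ⊗ den ≈ num → a ≈ z ⊗ r
    quotient n {p} {a} {num} {den} {r} den≉0 den≈ num≈ r*den≈num =
      DomainProperties.*-cancelˡ L den≉0 (begin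
        den ⊗ a                   ≈⟨ L.*-congʳ den≈ ⟩
        (z ⊗ z ^ n) ⊗ p ⊗ a       ≈⟨ solve 4 (λ z zⁿ p a → (z :* zⁿ) :* p :* a := z :* (zⁿ :* (p :* a)))
                                       L.refl z (z ^ n) p a ⟩
        z ⊗ (z ^ n ⊗ (p ⊗ a))     ≈⟨ L.*-congˡ num≈ ⟨
        z ⊗ num                   ≈⟨ L.*-congˡ r*den≈num ⟨
        z ⊗ (r ⊗ den)             ≈⟨ solve 3 (λ z r d → z :* (r :* d) := d :* (z :* r)) L.refl z r den ⟩
        den ⊗ (z ⊗ r)             ∎)

module LaurentProperties {c ℓ : Level} (D : IntegralDomain c ℓ) where
  private
    module D = IntegralDomain D
    module S = PowerSeries D
    module E = IntegralDomain S.integralDomain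
    module Q = Fractions S.integralDomain
    module L = IntegralDomain Q.integralDomain
  open D using (Carrier; 0#; 1#)
  open FractionProperties S.integralDomain
  open SemiringExp L.semiring using (_^_)
  open SemiringSum L.semiring using () renaming (sum to ∑ᴸ)
  open SemiringSum D.semiring using () renaming (sum to ∑ᴰ)
  open RangeSums Q.integralDomain

  constant : Carrier → L.Carrier
  constant a = Q.ι (S.const a)

  z w : L.Carrier
  z = Q.fraction (S.const 1#) S.var S.var≉0
  w = Q.ι S.var

  open InverseVariable Q.integralDomain z w (Q.cross (E.*-assoc E.1# S.var E.1#))

  constant-cong : ∀ {a b} → a D.≈ b → constant a L.≈ constant b
  constant-cong a≈b = ι-cong (S.coeffwise λ { zero → a≈b ; (suc n) → D.refl })

  constant-+ : ∀ a b → constant (a D.+ b) L.≈ constant a L.+ constant b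
  constant-+ a b = L.trans
    (ι-cong (S.coeffwise λ { zero → D.refl ; (suc n) → D.sym (D.+-identityˡ 0#) }))
    (ι-+ (S.const a) (S.const b))

  constant-∑ : ∀ {n} (h : Fin n → Carrier) → constant (∑ᴰ h) L.≈ ∑ᴸ (λ i → constant (h i))
  constant-∑ {zero}  h = L.refl
  constant-∑ {suc n} h = L.trans (constant-+ (h zero) (∑ᴰ h′))
    (L.+-congˡ {constant (h zero)} {constant (∑ᴰ h′)} {∑ᴸ (λ i → constant (h′ i))} (constant-∑ h′))
    where
    h′ : Fin n → Carrier
    h′ i = h (suc i)

  drop : ℕ → S.Series → S.Series
  drop i a n = a (i + n)

  drop-step : ∀ i a → drop i a E.≈ S.const (a i) E.+ S.var E.* drop (suc i) a
  drop-step i a = S.coeffwise λ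
    { zero    → D.sym (D.trans
        (D.+-congˡ (D.trans (D.+-identityʳ _) (D.zeroˡ (a (suc i + 0)))))
        (D.trans (D.+-identityʳ (a i)) (D.reflexive (≡.cong a (≡.sym (ℕ.+-identityʳ i))))))
    ; (suc n) → D.sym (D.trans (D.+-identityˡ _) (D.trans (D.+-cong (D.zeroˡ _)
        (D.+-cong (D.*-identityˡ (a (suc i + n)))
          (D.trans (SemiringSum.sum-cong-≋ D.semiring {n} (λ i → D.zeroˡ _))
            (SemiringSum.sum-replicate-zero D.semiring n))))
        (D.trans (D.+-identityˡ _) (D.trans (D.+-identityʳ _)
          (D.reflexive (≡.cong a (≡.sym (ℕ.+-suc i n))))))))
    }

  ∑-constant : ∀ n a → (∀ i → n ≤ i → a (suc i) D.≈ 0#) →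
               ∑≤ n (λ i → constant (a i) L.* z ^ (n ∸ i)) L.≈ z ^ n L.* Q.ι a
  ∑-constant n a a≈0 = horner n (λ i → constant (a i)) (λ i → Q.ι (drop i a))
    (λ i → L.trans (ι-cong (drop-step i a)) (L.trans
      (ι-+ (S.const (a i)) (S.var E.* drop (suc i) a))
      (L.+-congˡ {constant (a i)} {Q.ι (S.var E.* drop (suc i) a)} {w L.* Q.ι (drop (suc i) a)}
        (ι-* S.var (drop (suc i) a)))))
    (ι-cong (S.coeffwise λ
      { zero    → D.reflexive (≡.cong a (ℕ.+-identityʳ n))
      ; (suc i) → D.trans (D.reflexive (≡.cong a (ℕ.+-suc n i))) (a≈0 (n + i) (ℕ.m≤m+n n i)) }))

  module _ (n : ℕ) (p a : S.Series)
    (p-vanishing : ∀ i → suc n ≤ i → p (suc i) D.≈ 0#)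
    (p*a-vanishing : ∀ i → n ≤ i → (p S.* a) (suc i) D.≈ 0#)
    (p₀≉0 : ¬ (p 0 D.≈ 0#))
    {num den : L.Carrier}
    (num≈ : num L.≈ ∑≤ n (λ i → ∑≤ i (λ j → constant (p j D.* a (i ∸ j)) L.* z ^ (n ∸ i))))
    (den≈ : den L.≈ ∑≤ (suc n) (λ i → constant (p i) L.* z ^ (suc n ∸ i)))
    where

    -- The double sum collects the coefficients of the Cauchy product `p S.* a` up to degree `n`,
    -- and by `p*a-vanishing` the cut loses nothing. The denominator is a power of `z` times the
    -- series `p`, which is nonzero because its constant term is.
    rational : Σ[ den≉0 ∈ ¬ (den L.≈ L.0#) ] Q.ι a L.≈ z L.* (num Q.÷ den [ den≉0 ])
    rational = den≉0 , quotient n {Q.ι p} {Q.ι a} {num} {den} {num Q.÷ den [ den≉0 ]}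
      den≉0 den≈′ num≈′ (÷-* num den den≉0)
      where
      den≈′ : den L.≈ z ^ suc n L.* Q.ι p
      den≈′ = L.trans den≈ (∑-constant (suc n) p p-vanishing)

      num≈′ : num L.≈ z ^ n L.* (Q.ι p L.* Q.ι a)
      num≈′ = L.trans num≈ (L.trans
        (∑≤-double n (λ i j → constant (p j D.* a (i ∸ j))) (λ i → constant ((p S.* a) i))
          (λ i → constant-∑ {suc i} (λ j → p (toℕ j) D.* a (i ∸ toℕ j))))
        (L.trans (∑-constant n (p S.* a) p*a-vanishing)
          (L.*-congˡ {z ^ n} {Q.ι (p S.* a)} {Q.ι p L.* Q.ι a} (ι-* p a))))

      den≉0 : ¬ (den L.≈ L.0#)
      den≉0 = nonzero (suc n) {Q.ι p} {den} (Q.ι≉0 (λ p≈0 → p₀≉0 (S.at p≈0 0))) den≈′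

-- Pascal-type relations for the Fibopolynomials.

module _ {c ℓ : Level} (D : IntegralDomain c ℓ) where
  open IntegralDomain D using (Carrier; _≈_; 0#; 1#) renaming (_*_ to _⊗_)
  open CommutativeMonoidSum (IntegralDomain.*-commutativeMonoid D) using () renaming (sum to ∏)

  module QuotientsOfProducts
    (w : ℕ → Carrier) (w-zero : w 0 ≈ 0#) (w≉0 : ∀ n → ¬ (w (suc n) ≈ 0#))
    (b : ℕ → ℕ → Carrier)
    (b-∏ : ∀ n j → b n j ⊗ ∏ {j} (λ i → w (suc (toℕ i))) ≈ ∏ {j} (λ i → w (n ∸ toℕ i)))
    where
    private module D = IntegralDomain D
    open DomainProperties D using (*-cancelˡ; ∏-≉0)
    open SetoidReasoning D.setoid
    open SemiringSolver D.commutativeSemiring using (solve; _:=_; _:*_)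

    private
      falling : ℕ → ℕ → Carrier
      falling n j = ∏ {j} (λ i → w (n ∸ toℕ i))

      factorial : ℕ → Carrier
      factorial j = ∏ {j} (λ i → w (suc (toℕ i)))

      factorial≉0 : ∀ j → ¬ (factorial j ≈ 0#)
      factorial≉0 j = ∏-≉0 {j} _ (λ i → w≉0 (toℕ i))

      ∏-last : ∀ j (h : ℕ → Carrier) → ∏ {suc j} (λ i → h (toℕ i)) ≈ ∏ {j} (λ i → h (toℕ i)) ⊗ h j
      ∏-last zero    h = D.*-comm (h 0) 1#
      ∏-last (suc j) h = D.trans (D.*-congˡ (∏-last j (λ i → h (suc i)))) (D.sym (D.*-assoc _ _ _))

      -- The factor with `i = n` is `w 0`.
      falling-vanishing : ∀ n j → n ≤ j → falling n (suc j) ≈ 0#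
      falling-vanishing zero    j       _         = D.trans (D.*-congʳ w-zero) (D.zeroˡ _)
      falling-vanishing (suc n) (suc j) (s≤s n≤j) = D.trans (D.*-congˡ (falling-vanishing n j n≤j)) (D.zeroʳ _)

    b-zero : ∀ n → b n 0 ≈ 1#
    b-zero n = D.trans (D.sym (D.*-identityʳ (b n 0))) (b-∏ n 0)

    b-vanishing : ∀ n j → n ≤ j → b n (suc j) ≈ 0#
    b-vanishing n j n≤j = *-cancelˡ (factorial≉0 (suc j)) (begin
      factorial (suc j) ⊗ b n (suc j)   ≈⟨ D.*-comm _ _ ⟩
      b n (suc j) ⊗ factorial (suc j)   ≈⟨ b-∏ n (suc j) ⟩
      falling n (suc j)                 ≈⟨ falling-vanishing n j n≤j ⟩
      0#                                ≈⟨ D.zeroʳ _ ⟨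
      factorial (suc j) ⊗ 0#            ∎)

    -- Times `factorial j`, both sides become `falling (suc n) (suc j)`, with its last factor split
    -- off on the left and its first on the right. Truncated subtraction makes this valid for every
    -- `j`.
    b-lower : ∀ n j → b (suc n) j ⊗ w (suc n ∸ j) ≈ w (suc n) ⊗ b n j
    b-lower n j = *-cancelˡ (factorial≉0 j) (begin
      factorial j ⊗ (b (suc n) j ⊗ w (suc n ∸ j))
        ≈⟨ solve 3 (λ d b w → d :* (b :* w) := (b :* d) :* w) D.refl _ _ _ ⟩
      b (suc n) j ⊗ factorial j ⊗ w (suc n ∸ j)
        ≈⟨ D.*-congʳ (b-∏ (suc n) j) ⟩
      falling (suc n) j ⊗ w (suc n ∸ j)
        ≈⟨ ∏-last j (λ i → w (suc n ∸ i)) ⟨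
      w (suc n) ⊗ falling n j
        ≈⟨ D.*-congˡ (b-∏ n j) ⟨
      w (suc n) ⊗ (b n j ⊗ factorial j)
        ≈⟨ solve 3 (λ w b d → w :* (b :* d) := d :* (w :* b)) D.refl _ _ _ ⟩
      factorial j ⊗ (w (suc n) ⊗ b n j) ∎)

    b-diagonal : ∀ n j → b (suc n) (suc j) ⊗ w (suc j) ≈ w (suc n) ⊗ b n j
    b-diagonal n j = *-cancelˡ (factorial≉0 j) (begin
      factorial j ⊗ (b (suc n) (suc j) ⊗ w (suc j))
        ≈⟨ solve 3 (λ d b w → d :* (b :* w) := b :* (d :* w)) D.refl _ _ _ ⟩
      b (suc n) (suc j) ⊗ (factorial j ⊗ w (suc j))
        ≈⟨ D.*-congˡ (∏-last j (λ i → w (suc i))) ⟨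
      b (suc n) (suc j) ⊗ factorial (suc j)
        ≈⟨ b-∏ (suc n) (suc j) ⟩
      w (suc n) ⊗ falling n j
        ≈⟨ D.*-congˡ (b-∏ n j) ⟨
      w (suc n) ⊗ (b n j ⊗ factorial j)
        ≈⟨ solve 3 (λ w b d → w :* (b :* d) := d :* (w :* b)) D.refl _ _ _ ⟩
      factorial j ⊗ (w (suc n) ⊗ b n j) ∎)

-- Signs and powers of y.

module _ {c ℓ : Level} (D : IntegralDomain c ℓ) where
  open IntegralDomain D using (Carrier; _≈_; 0#; 1#) renaming (_*_ to _⊗_)
  open SemiringExp (IntegralDomain.semiring D) using (_^_)

  module Signs
    (u y q : Carrier) (u*u≈1 : u ⊗ u ≈ 1#) (q≈u*y : q ≈ u ⊗ y) (s : ℕ)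
    where
    private module D = IntegralDomain D
    open SetoidReasoning D.setoid
    open SemiringSolver D.commutativeSemiring using (solve; _:=_; _:*_; con)
    open SemiringExp D.semiring using (^-homo-*; ^-assocʳ; ^-congˡ)
    open CommutativeSemiringExp D.commutativeSemiring using (^-distrib-*)

    private
      -- This holds for odd `m` too, so the recursions of the exponents require evenness of their
      -- increments only.
      halve : ∀ m k → (m + k * 2) / 2 ≡ m / 2 + k
      halve m k = ≡.trans (+-distrib-/-∣ʳ m (divides-refl k)) (≡.cong (λ h → m / 2 + h) (m*n/n≡m k 2))

      u-exponent y-exponent : ℕ → ℕ
      u-exponent j = ((s * j + 2 * (s + 1)) * (j + 1)) / 2
      y-exponent j = (s * j * (j ∸ 1)) / 2

      u-exponent-suc : ∀ j → u-exponent (suc j) ≡ u-exponent j + (s * j + s + s + 1)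
      u-exponent-suc j = ≡.trans
        (≡.cong (_/ 2) (solveℕ 2 (λ s j →
          (s ⊛ (c1 ⊞ j) ⊞ c2 ⊛ (s ⊞ c1)) ⊛ (c1 ⊞ j ⊞ c1)
          ⊜ (s ⊛ j ⊞ c2 ⊛ (s ⊞ c1)) ⊛ (j ⊞ c1) ⊞ (s ⊛ j ⊞ s ⊞ s ⊞ c1) ⊛ c2) ≡.refl s j))
        (halve ((s * j + 2 * (s + 1)) * (j + 1)) (s * j + s + s + 1))
        where
        open +-*-Solver using () renaming (solve to solveℕ; _:+_ to _⊞_; _:*_ to _⊛_; _:=_ to _⊜_; con to conℕ)
        c1 = conℕ 1
        c2 = conℕ 2

      y-exponent-suc : ∀ j → y-exponent (suc j) ≡ y-exponent j + s * j
      y-exponent-suc j = ≡.trans (≡.cong (_/ 2) (numerator j)) (halve (s * j * (j ∸ 1)) (s * j))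
        where
        open +-*-Solver using () renaming (solve to solveℕ; _:+_ to _⊞_; _:*_ to _⊛_; _:=_ to _⊜_; con to conℕ)
        numerator : ∀ j → s * suc j * j ≡ s * j * (j ∸ 1) + s * j * 2
        numerator zero    = solveℕ 1 (λ s → s ⊛ conℕ 1 ⊛ conℕ 0 ⊜ s ⊛ conℕ 0 ⊛ conℕ 0 ⊞ s ⊛ conℕ 0 ⊛ conℕ 2) ≡.refl s
        numerator (suc j) = solveℕ 2 (λ s j → s ⊛ (conℕ 2 ⊞ j) ⊛ (conℕ 1 ⊞ j)
          ⊜ s ⊛ (conℕ 1 ⊞ j) ⊛ j ⊞ s ⊛ (conℕ 1 ⊞ j) ⊛ conℕ 2) ≡.refl s j

    weight : ℕ → Carrier
    weight j = u ^ u-exponent j ⊗ y ^ y-exponent j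

    -- The exponents of `u` and `y` grow by `s * j + s + s + 1` and `s * j`. The part `s + s`
    -- disappears because `u` squares to one, and the rest combines to `u` times
    -- `(u ⊗ y) ^ (s * j)`.
    weight-suc : ∀ j → weight (suc j) ≈ u ⊗ (q ^ s) ^ j ⊗ weight j
    weight-suc j = begin
      u ^ u-exponent (suc j) ⊗ y ^ y-exponent (suc j)
        ≡⟨ ≡.cong₂ (λ m n → u ^ m ⊗ y ^ n) (u-exponent-suc j) (y-exponent-suc j) ⟩
      u ^ (u-exponent j + (s * j + s + s + 1)) ⊗ y ^ (y-exponent j + s * j)
        ≈⟨ D.*-cong u-split (^-homo-* y (y-exponent j) (s * j)) ⟩
      U ⊗ (Uʲ ⊗ (Uˢ ⊗ Uˢ) ⊗ u) ⊗ (Y ⊗ Yʲ)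
        ≈⟨ D.*-congʳ (D.*-congˡ (D.*-congʳ (D.*-congˡ uˢ*uˢ≈1))) ⟩
      U ⊗ (Uʲ ⊗ 1# ⊗ u) ⊗ (Y ⊗ Yʲ)
        ≈⟨ solve 5 (λ U Uʲ u Y Yʲ → U :* (Uʲ :* con 1 :* u) :* (Y :* Yʲ) := u :* (Uʲ :* Yʲ) :* (U :* Y))
             D.refl U Uʲ u Y Yʲ ⟩
      u ⊗ (Uʲ ⊗ Yʲ) ⊗ (U ⊗ Y)
        ≈⟨ D.*-congʳ (D.*-congˡ (begin
             (q ^ s) ^ j           ≈⟨ ^-assocʳ q s j ⟩
             q ^ (s * j)           ≈⟨ ^-congˡ (s * j) q≈u*y ⟩
             (u ⊗ y) ^ (s * j)     ≈⟨ ^-distrib-* u y (s * j) ⟩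
             Uʲ ⊗ Yʲ               ∎)) ⟨
      u ⊗ (q ^ s) ^ j ⊗ (U ⊗ Y) ∎
      where
      U = u ^ u-exponent j
      Y = y ^ y-exponent j
      Uʲ = u ^ (s * j)
      Yʲ = y ^ (s * j)
      Uˢ = u ^ s

      u-split : u ^ (u-exponent j + (s * j + s + s + 1)) ≈ U ⊗ (Uʲ ⊗ (Uˢ ⊗ Uˢ) ⊗ u)
      u-split = begin
        u ^ (u-exponent j + (s * j + s + s + 1))
          ≈⟨ ^-homo-* u (u-exponent j) (s * j + s + s + 1) ⟩
        U ⊗ u ^ (s * j + s + s + 1)
          ≈⟨ D.*-congˡ (D.trans (^-homo-* u (s * j + s + s) 1) (D.*-cong
               (D.trans (^-homo-* u (s * j + s) s) (D.*-congʳ (^-homo-* u (s * j) s)))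
               (D.*-identityʳ u))) ⟩
        U ⊗ (Uʲ ⊗ Uˢ ⊗ Uˢ ⊗ u)
          ≈⟨ D.*-congˡ (D.*-congʳ (D.*-assoc Uʲ Uˢ Uˢ)) ⟩
        U ⊗ (Uʲ ⊗ (Uˢ ⊗ Uˢ) ⊗ u) ∎

      uˢ*uˢ≈1 : Uˢ ⊗ Uˢ ≈ 1#
      uˢ*uˢ≈1 = D.trans (D.sym (^-distrib-* u u s)) (D.trans (^-congˡ s u*u≈1) (one^ s))
        where
        one^ : ∀ n → 1# ^ n ≈ 1#
        one^ zero    = D.refl
        one^ (suc n) = D.trans (D.*-identityˡ _) (one^ n)

-- Integer indices, and F_{tsn+m} as a form of degree t.

module _ {c ℓ : Level} (D : IntegralDomain c ℓ) where
  open IntegralDomain D using (Carrier; _≈_; 0#; 1#) renaming (_+_ to _⊕_; _*_ to _⊗_)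
  open SemiringExp (IntegralDomain.semiring D) using (_^_)

  module IntegerIndices
    (x y q : Carrier) (q≉0 : ¬ (q ≈ 0#)) (q+y≈0 : q ⊕ y ≈ 0#)
    (F : ℤ → Carrier) (F₀≈0 : F (+ 0) ≈ 0#) (F₁≈1 : F (+ 1) ≈ 1#)
    (F-solution : ∀ n → F (+ suc (suc n)) ≈ x ⊗ F (+ suc n) ⊕ y ⊗ F (+ n))
    (F-negative : ∀ n → F -[1+ n ] ⊗ q ^ suc n ⊕ F (+ suc n) ≈ 0#)
    (s : ℕ)
    where
    private module D = IntegralDomain D
    open SecondOrder D.commutativeSemiring x y q q+y≈0
    open DomainProperties D using (*-cancelˡ; ^-≉0)
    open GroupProperties D.+-group using () renaming (∙-cancelʳ to +-cancelʳ)
    open SetoidReasoning D.setoid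
    open SemiringSolver D.commutativeSemiring using (solve; _:=_; _:+_; _:*_; con)
    open SemiringExp D.semiring using (^-assocʳ)

    private
      y*y≈q*q : y ⊗ y ≈ q ⊗ q
      y*y≈q*q = +-cancelʳ (q ⊗ y) (y ⊗ y) (q ⊗ q) (begin
        y ⊗ y ⊕ q ⊗ y     ≈⟨ solve 2 (λ y q → y :* y :+ q :* y := (q :+ y) :* y) D.refl y q ⟩
        (q ⊕ y) ⊗ y       ≈⟨ D.*-congʳ q+y≈0 ⟩
        0# ⊗ y            ≈⟨ D.trans (D.zeroˡ y) (D.sym (D.zeroʳ q)) ⟩
        q ⊗ 0#            ≈⟨ D.*-congˡ q+y≈0 ⟨
        q ⊗ (q ⊕ y)       ≈⟨ D.distribˡ q q y ⟩
        q ⊗ q ⊕ q ⊗ y     ∎)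

      negative : ∀ n → F (ℤ.- (+ n)) ⊗ q ^ n ⊕ F (+ n) ≈ 0#
      negative zero    = D.trans (D.+-cong (D.trans (D.*-identityʳ _) F₀≈0) F₀≈0) (D.+-identityˡ 0#)
      negative (suc n) = F-negative n

      -- Multiplied by q^(n+2), this becomes the recurrence at the index n.
      negative-recurrence : ∀ n → F (ℤ.- (+ n)) ≈ x ⊗ F -[1+ n ] ⊕ y ⊗ F -[1+ suc n ]
      negative-recurrence n = *-cancelˡ (^-≉0 (suc (suc n)) q≉0)
        (+-cancelʳ (q ⊗ q ⊗ f₀) (q ⊗ (q ⊗ qⁿ) ⊗ v₀) (q ⊗ (q ⊗ qⁿ) ⊗ (x ⊗ v₁ ⊕ y ⊗ v₂)) (D.trans left (D.sym right)))
        where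
        qⁿ = q ^ n
        v₀ = F (ℤ.- (+ n))
        v₁ = F -[1+ n ]
        v₂ = F -[1+ suc n ]
        f₀ = F (+ n)
        f₁ = F (+ suc n)
        f₂ = F (+ suc (suc n))

        left : q ⊗ (q ⊗ qⁿ) ⊗ v₀ ⊕ q ⊗ q ⊗ f₀ ≈ 0#
        left = begin
          q ⊗ (q ⊗ qⁿ) ⊗ v₀ ⊕ q ⊗ q ⊗ f₀
            ≈⟨ solve 4 (λ q qⁿ v f → q :* (q :* qⁿ) :* v :+ q :* q :* f := q :* q :* (v :* qⁿ :+ f)) D.refl q qⁿ v₀ f₀ ⟩
          q ⊗ q ⊗ (v₀ ⊗ qⁿ ⊕ f₀)
            ≈⟨ D.trans (D.*-congˡ (negative n)) (D.zeroʳ _) ⟩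
          0# ∎

        right : q ⊗ (q ⊗ qⁿ) ⊗ (x ⊗ v₁ ⊕ y ⊗ v₂) ⊕ q ⊗ q ⊗ f₀ ≈ 0#
        right = begin
          q ⊗ (q ⊗ qⁿ) ⊗ (x ⊗ v₁ ⊕ y ⊗ v₂) ⊕ q ⊗ q ⊗ f₀
            ≈⟨ D.+-congˡ (begin
              q ⊗ q ⊗ f₀
                ≈⟨ D.*-congʳ y*y≈q*q ⟨
              y ⊗ y ⊗ f₀
                ≈⟨ D.+-identityˡ _ ⟨
              0# ⊕ y ⊗ y ⊗ f₀
                ≈⟨ D.+-congʳ (D.trans (D.*-congʳ q+y≈0) (D.zeroˡ _)) ⟨
              (q ⊕ y) ⊗ (x ⊗ f₁) ⊕ y ⊗ y ⊗ f₀
                ≈⟨ solve 5 (λ q y x f₁ f₀ → (q :+ y) :* (x :* f₁) :+ y :* y :* f₀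
                     := x :* q :* f₁ :+ y :* (x :* f₁ :+ y :* f₀)) D.refl q y x f₁ f₀ ⟩
              x ⊗ q ⊗ f₁ ⊕ y ⊗ (x ⊗ f₁ ⊕ y ⊗ f₀)
                ≈⟨ D.+-congˡ (D.*-congˡ (F-solution n)) ⟨
              x ⊗ q ⊗ f₁ ⊕ y ⊗ f₂ ∎) ⟩
          q ⊗ (q ⊗ qⁿ) ⊗ (x ⊗ v₁ ⊕ y ⊗ v₂) ⊕ (x ⊗ q ⊗ f₁ ⊕ y ⊗ f₂)
            ≈⟨ solve 8 (λ q qⁿ x v₁ y v₂ f₁ f₂ →
                 q :* (q :* qⁿ) :* (x :* v₁ :+ y :* v₂) :+ (x :* q :* f₁ :+ y :* f₂)
                 := x :* q :* (v₁ :* (q :* qⁿ) :+ f₁) :+ y :* (v₂ :* (q :* (q :* qⁿ)) :+ f₂))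
                 D.refl q qⁿ x v₁ y v₂ f₁ f₂ ⟩
          x ⊗ q ⊗ (v₁ ⊗ (q ⊗ qⁿ) ⊕ f₁) ⊕ y ⊗ (v₂ ⊗ (q ⊗ (q ⊗ qⁿ)) ⊕ f₂)
            ≈⟨ D.+-cong (D.*-congˡ (negative (suc n))) (D.*-congˡ (negative (suc (suc n)))) ⟩
          x ⊗ q ⊗ 0# ⊕ y ⊗ 0#
            ≈⟨ solve 3 (λ x q y → x :* q :* con 0 :+ y :* con 0 := con 0) D.refl x q y ⟩
          0# ∎

      -- The single instance whose indices -1, 0, 1 lie on both sides of zero; it falls under
      -- neither `F-solution` nor `negative-recurrence`.
      recurrence-at-1 : F (+ 1) ≈ x ⊗ F (+ 0) ⊕ y ⊗ F -[1+ 0 ]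
      recurrence-at-1 = +-cancelʳ (q ⊗ F -[1+ 0 ]) _ _ (begin
        F (+ 1) ⊕ q ⊗ v
          ≈⟨ solve 3 (λ f q v → f :+ q :* v := v :* (q :* con 1) :+ f) D.refl (F (+ 1)) q v ⟩
        v ⊗ (q ⊗ 1#) ⊕ F (+ 1)
          ≈⟨ negative 1 ⟩
        0#
          ≈⟨ solve 2 (λ x v → x :* con 0 :+ con 0 :* v := con 0) D.refl x v ⟨
        x ⊗ 0# ⊕ 0# ⊗ v
          ≈⟨ D.+-cong (D.*-congˡ F₀≈0) (D.*-congʳ q+y≈0) ⟨
        x ⊗ F (+ 0) ⊕ (q ⊕ y) ⊗ v
          ≈⟨ solve 5 (λ x f q y v → x :* f :+ (q :+ y) :* v := (x :* f :+ y :* v) :+ q :* v) D.refl x (F (+ 0)) q y v ⟩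
        (x ⊗ F (+ 0) ⊕ y ⊗ v) ⊕ q ⊗ v ∎)
        where
        v = F -[1+ 0 ]

    recurrence : ∀ p → F (ℤ.suc (ℤ.suc p)) ≈ x ⊗ F (ℤ.suc p) ⊕ y ⊗ F p
    recurrence (+ n)              = F-solution n
    recurrence -[1+ 0 ]           = recurrence-at-1
    recurrence -[1+ 1 ]           = negative-recurrence 0
    recurrence -[1+ suc (suc n) ] = negative-recurrence (suc n)

    private
      +-suc : ∀ p n → p ℤ.+ + suc n ≡ ℤ.suc (p ℤ.+ + n)
      +-suc p n = ≡.trans (≡.sym (ℤ.+-assoc p (+ 1) (+ n)))
        (≡.trans (≡.cong (λ k → k ℤ.+ + n) (ℤ.+-comm p (+ 1))) (ℤ.+-assoc (+ 1) p (+ n)))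

    translate-solution : ∀ p → Solution (λ n → F (p ℤ.+ + n))
    translate-solution p n = D.trans
      (D.reflexive (≡.cong F (≡.trans (+-suc p (suc n)) (≡.cong ℤ.suc (+-suc p n)))))
      (D.trans (recurrence (p ℤ.+ + n))
        (D.+-congʳ (D.*-congˡ (D.reflexive (≡.cong F (≡.sym (+-suc p n)))))))

    open Forms D (λ n → F (+ (s * n))) (q ^ s)

    -- d'Ocagne's identity at the indices `s * i` and `s * j`, for the solution started at
    -- `p + s * n`.
    elementary : ∀ p → Elementary (λ n → F (p ℤ.+ + (s * n)))
    elementary p i j n = begin
      F (+ (s * (i + j))) ⊗ h (s * (n + i))
        ≡⟨ ≡.cong₂ (λ k k′ → F (+ k) ⊗ h k′) (ℕ.*-distribˡ-+ s i j) (ℕ.*-distribˡ-+ s n i) ⟩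
      F (+ (s * i + s * j)) ⊗ h (s * n + s * i)
        ≈⟨ d'Ocagne F₀≈0 F₁≈1 F-solution (solution-shift (translate-solution p) (s * n)) (s * i) (s * j) ⟩
      F (+ (s * i)) ⊗ h (s * n + (s * i + s * j)) ⊕ q ^ (s * i) ⊗ F (+ (s * j)) ⊗ h (s * n + 0)
        ≡⟨ ≡.cong₂ (λ k k′ → F (+ (s * i)) ⊗ h k ⊕ q ^ (s * i) ⊗ F (+ (s * j)) ⊗ h k′)
             (≡.trans (≡.cong (λ h → s * n + h) (≡.sym (ℕ.*-distribˡ-+ s i j))) (≡.sym (ℕ.*-distribˡ-+ s n (i + j))))
             (ℕ.+-identityʳ (s * n)) ⟩
      F (+ (s * i)) ⊗ h (s * (n + (i + j))) ⊕ q ^ (s * i) ⊗ F (+ (s * j)) ⊗ h (s * n)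
        ≈⟨ D.+-congˡ (D.*-congʳ (D.*-congʳ (^-assocʳ q s i))) ⟨
      F (+ (s * i)) ⊗ h (s * (n + (i + j))) ⊕ (q ^ s) ^ i ⊗ F (+ (s * j)) ⊗ h (s * n) ∎
      where
      h : ℕ → Carrier
      h n = F (p ℤ.+ + n)

    -- F_{(t+1)sn+m} = F_{sn+1} F_{tsn+m} + y F_{sn} F_{tsn+m-1} raises the degree by one.
    form : ∀ t m → Form t (λ n → F (+ (t * s * n) ℤ.+ m))
    form zero    m = resp
      (λ n → D.trans (D.*-identityʳ (F m)) (D.reflexive (≡.cong F (≡.sym (ℤ.+-identityˡ m)))))
      (scale (F m) one)
    form (suc t) m = resp split
      (add (mul (elementary (+ 1)) (form t m)) (scale y (mul (elementary (+ 0)) (form t (ℤ.pred m)))))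
      where
      split : ∀ n → F (+ suc (s * n)) ⊗ F (+ (t * s * n) ℤ.+ m)
                      ⊕ y ⊗ (F (+ (s * n)) ⊗ F (+ (t * s * n) ℤ.+ ℤ.pred m))
                    ≈ F (+ (suc t * s * n) ℤ.+ m)
      split n = D.sym (begin
        F (+ (suc t * s * n) ℤ.+ m)
          ≡⟨ ≡.cong F index ⟩
        F (p ℤ.+ + suc (s * n))
          ≈⟨ addition F₀≈0 F₁≈1 F-solution (translate-solution p) (s * n) ⟩
        F (+ suc (s * n)) ⊗ F (p ℤ.+ + 1) ⊕ y ⊗ F (+ (s * n)) ⊗ F (p ℤ.+ + 0)
          ≡⟨ ≡.cong₂ (λ k k′ → F (+ suc (s * n)) ⊗ F k ⊕ y ⊗ F (+ (s * n)) ⊗ F k′) index₁ (ℤ.+-identityʳ p) ⟩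
        F (+ suc (s * n)) ⊗ F (+ (t * s * n) ℤ.+ m) ⊕ y ⊗ F (+ (s * n)) ⊗ F p
          ≈⟨ D.+-congˡ (D.*-assoc _ _ _) ⟩
        F (+ suc (s * n)) ⊗ F (+ (t * s * n) ℤ.+ m) ⊕ y ⊗ (F (+ (s * n)) ⊗ F p) ∎)
        where
        a = t * s * n
        -- The base lies one below `+ a ℤ.+ m` because `addition` expands a successor index; hence
        -- the term with `ℤ.pred m`.
        p = + a ℤ.+ ℤ.pred m

        index₁ : p ℤ.+ + 1 ≡ + a ℤ.+ m
        index₁ = ≡.trans (ℤ.+-assoc (+ a) (ℤ.pred m) (+ 1))
          (≡.cong (λ k → + a ℤ.+ k) (≡.trans (ℤ.+-comm (ℤ.pred m) (+ 1)) (ℤ.suc-pred m)))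

        index : + (suc t * s * n) ℤ.+ m ≡ p ℤ.+ + suc (s * n)
        index = ≡R.begin
          + ((s + t * s) * n) ℤ.+ m         ≡R.≡⟨ ≡.cong (λ k → + k ℤ.+ m) (≡.trans (ℕ.*-distribʳ-+ n s (t * s)) (ℕ.+-comm (s * n) a)) ⟩
          + a ℤ.+ + (s * n) ℤ.+ m           ≡R.≡⟨ ℤ.+-assoc (+ a) (+ (s * n)) m ⟩
          + a ℤ.+ (+ (s * n) ℤ.+ m)         ≡R.≡⟨ ≡.cong (λ k → + a ℤ.+ k) (ℤ.+-comm (+ (s * n)) m) ⟩
          + a ℤ.+ (m ℤ.+ + (s * n))         ≡R.≡⟨ ℤ.+-assoc (+ a) m (+ (s * n)) ⟨
          + a ℤ.+ m ℤ.+ + (s * n)           ≡R.≡⟨ ≡.cong (λ k → k ℤ.+ + (s * n)) index₁ ⟨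
          p ℤ.+ + 1 ℤ.+ + (s * n)           ≡R.≡⟨ ℤ.+-assoc p (+ 1) (+ (s * n)) ⟩
          p ℤ.+ + suc (s * n)               ≡R.∎
          where module ≡R = ≡.≡-Reasoning

-- The transform over an arbitrary domain.

-- Records do not unfold, so passing an instance for the concrete field k(x,y) only makes
-- the type checker compare the parameters, never the nested fractions in the fields.
module Axioms {c ℓ : Level} (D : IntegralDomain c ℓ) where
  open IntegralDomain D using (Carrier; _≈_; 0#; 1#; -_) renaming (_+_ to _⊕_; _*_ to _⊗_)
  open SemiringExp (IntegralDomain.semiring D) using (_^_)
  open CommutativeMonoidSum (IntegralDomain.*-commutativeMonoid D) using () renaming (sum to ∏)

  record IsFibonacci (x y : Carrier) (F : ℤ → Carrier) : Set (c ⊔ ℓ) where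
    field
      y≉0        : ¬ (y ≈ 0#)
      F₀≈0       : F (+ 0) ≈ 0#
      F₁≈1       : F (+ 1) ≈ 1#
      F-solution : ∀ n → F (+ suc (suc n)) ≈ x ⊗ F (+ suc n) ⊕ y ⊗ F (+ n)
      F-negative : ∀ n → F -[1+ n ] ⊗ (- y) ^ suc n ⊕ F (+ suc n) ≈ 0#
      F≉0        : ∀ n .{{_ : NonZero n}} → ¬ (F (+ n) ≈ 0#)

  record IsFibopolynomial (F : ℤ → Carrier) (b : (s n j : ℕ) .{{_ : NonZero s}} → Carrier) : Set (c ⊔ ℓ) where
    field
      b-∏ : ∀ s .{{_ : NonZero s}} n j →
            b s n j ⊗ ∏ {j} (λ i → F (+ (s * suc (toℕ i)))) ≈ ∏ {j} (λ i → F (+ (s * (n ∸ toℕ i))))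

open Axioms using (IsFibonacci; IsFibopolynomial)

module _ {c ℓ : Level} (D : IntegralDomain c ℓ) where
  open IntegralDomain D using (Carrier; _≈_; 0#; 1#; -_) renaming (_+_ to _⊕_; _*_ to _⊗_)
  open SemiringExp (IntegralDomain.semiring D) using (_^_)

  module Transform
    {x y : Carrier} {F : ℤ → Carrier} (isFibonacci : IsFibonacci D x y F)
    {b : (s n j : ℕ) .{{_ : NonZero s}} → Carrier} (isFibopolynomial : IsFibopolynomial D F b)
    (s : ℕ) .{{_ : NonZero s}}
    {l : ℕ} (k t : Fin l → ℕ) (m : Fin l → ℤ)
    where
    open Axioms.IsFibonacci isFibonacci
    open Axioms.IsFibopolynomial isFibopolynomial
    open CommutativeMonoidSum (IntegralDomain.*-commutativeMonoid D) using () renaming (sum to ∏)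
    private
      module D = IntegralDomain D
      module L = IntegralDomain (Fractions.integralDomain (PowerSeries.integralDomain D))
    open RingProperties D.ring using (-1*x≈-x)
    open GroupProperties D.+-group using (⁻¹-involutive)
    open DomainProperties D using (^-≉0; -‿≉0)
    open SemiringSolver D.commutativeSemiring using (solve; _:=_; _:*_)
    open RangeSums (Fractions.integralDomain (PowerSeries.integralDomain D))
    open SemiringExp L.semiring using () renaming (_^_ to _^ᴸ_)
    open LaurentProperties D using (constant; z; constant-cong; rational)
    open Fractions (PowerSeries.integralDomain D) using (ι; _÷_[_])

    private
      w : ℕ → Carrier
      w n = F (+ (s * n))

      w≉0 : ∀ n → ¬ (w (suc n) ≈ 0#)
      w≉0 n = F≉0 (s * suc n) {{ℕ.m*n≢0 s (suc n)}}

      w-zero : w 0 ≈ 0#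
      w-zero = D.trans (D.reflexive (≡.cong (λ n → F (+ n)) (ℕ.*-zeroʳ s))) F₀≈0

      K : ℕ
      K = sum +-0-commutativeMonoid (λ r → k r * t r)

      open QuotientsOfProducts D w w-zero w≉0 (λ n j → b s n j) (b-∏ s)
      open Signs D (- 1#) y (- y) (D.trans (-1*x≈-x (- 1#)) (⁻¹-involutive 1#)) (D.sym (-1*x≈-x y)) s
      open IntegerIndices D x y (- y) (-‿≉0 y≉0) (D.-‿inverseˡ y) F F₀≈0 F₁≈1 F-solution F-negative s using (form)
      open Forms D w ((- y) ^ s)
      open Annihilator D w w-zero w≉0 (λ n j → b s n j) b-zero b-vanishing b-lower b-diagonal
        ((- y) ^ s) (- 1#) (D.-‿inverseʳ 1#) weight weight-suc

      a : ℕ → Carrier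
      a n = ∏ {l} (λ r → F (+ (t r * s * n) ℤ.+ m r) ^ k r)

      a-form : Form K a
      a-form = Form-∏ (λ r → k r * t r) (λ r n → F (+ (t r * s * n) ℤ.+ m r) ^ k r)
        (λ r → Form-^ (k r) (form (t r) (m r)))

      p : ℕ → Carrier
      p = coefficient (suc K)

      -- This is the coefficient of the highest power of z in the denominator: a power of -1 times a
      -- power of y.
      p₀≉0 : ¬ (p 0 ≈ 0#)
      p₀≉0 = D.*-≉0 (D.*-≉0 (^-≉0 (((s * 0 + 2 * (s + 1)) * (0 + 1)) / 2) (-‿≉0 D.1≉0))
                             (^-≉0 ((s * 0 * (0 ∸ 1)) / 2) y≉0))
        (λ b≈0 → D.1≉0 (D.trans (D.sym (b-zero (suc K))) b≈0))

      sgn : ℕ → Carrier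
      sgn j = (- 1#) ^ (((s * j + 2 * (s + 1)) * (j + 1)) / 2)

      numerator-term : ℕ → ℕ → Carrier
      numerator-term i j = sgn j ⊗ b s (K + 1) j
        ⊗ ∏ {l} (λ r → F (m r ℤ.+ + (t r * s * (i ∸ j))) ^ k r) ⊗ y ^ (s * j * (j ∸ 1) / 2)

      denominator-term : ℕ → Carrier
      denominator-term i = sgn i ⊗ b s (K + 1) i ⊗ y ^ (s * i * (i ∸ 1) / 2)

      numerator-term≈ : ∀ i j → numerator-term i j ≈ p j ⊗ a (i ∸ j)
      numerator-term≈ i j = D.trans
        (D.reflexive (≡.cong₂ (λ n A → sgn j ⊗ b s n j ⊗ A ⊗ y ^ (s * j * (j ∸ 1) / 2))
          (ℕ.+-comm K 1)
          (MonoidSum.sum-cong-≗ D.*-monoid {l} (λ r →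
            ≡.cong (λ n → F n ^ k r) (ℤ.+-comm (m r) (+ (t r * s * (i ∸ j))))))))
        (solve 4 (λ σ b a y → σ :* b :* a :* y := σ :* y :* b :* a) D.refl
          (sgn j) (b s (suc K) j) (a (i ∸ j)) (y ^ (s * j * (j ∸ 1) / 2)))

      denominator-term≈ : ∀ i → denominator-term i ≈ p i
      denominator-term≈ i = D.trans
        (D.*-congʳ (D.*-congˡ (D.reflexive (≡.cong (λ n → b s n i) (ℕ.+-comm K 1)))))
        (solve 3 (λ σ b y → σ :* b :* y := σ :* y :* b) D.refl
          (sgn i) (b s (suc K) i) (y ^ (s * i * (i ∸ 1) / 2)))

    numerator denominator : L.Carrier
    numerator   = ∑≤ K (λ i → ∑≤ i (λ j → constant (numerator-term i j) L.* z ^ᴸ (K ∸ i)))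
    denominator = ∑≤ (K + 1) (λ i → constant (denominator-term i) L.* z ^ᴸ (K + 1 ∸ i))

    private
      numerator≈ : numerator L.≈ ∑≤ K (λ i → ∑≤ i (λ j → constant (p j ⊗ a (i ∸ j)) L.* z ^ᴸ (K ∸ i)))
      numerator≈ = ∑≤-cong K _ (λ i → ∑≤ i (λ j → constant (p j ⊗ a (i ∸ j)) L.* z ^ᴸ (K ∸ i)))
        (λ i _ → ∑≤-cong i (λ j → constant (numerator-term i j) L.* z ^ᴸ (K ∸ i))
          (λ j → constant (p j ⊗ a (i ∸ j)) L.* z ^ᴸ (K ∸ i))
          (λ j _ → L.*-congʳ {z ^ᴸ (K ∸ i)} {constant (numerator-term i j)} {constant (p j ⊗ a (i ∸ j))}
            (constant-cong (numerator-term≈ i j))))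

      denominator≈ : denominator L.≈ ∑≤ (suc K) (λ i → constant (p i) L.* z ^ᴸ (suc K ∸ i))
      denominator≈ = L.trans {denominator} {∑≤ (suc K) (λ i → constant (denominator-term i) L.* z ^ᴸ (suc K ∸ i))}
        (L.reflexive (≡.cong (λ n → ∑≤ n (λ i → constant (denominator-term i) L.* z ^ᴸ (n ∸ i))) (ℕ.+-comm K 1)))
        (∑≤-cong (suc K) (λ i → constant (denominator-term i) L.* z ^ᴸ (suc K ∸ i))
          (λ i → constant (p i) L.* z ^ᴸ (suc K ∸ i))
          (λ i _ → L.*-congʳ {z ^ᴸ (suc K ∸ i)} {constant (denominator-term i)} {constant (p i)}
            (constant-cong (denominator-term≈ i))))

    transform : Σ[ denominator≉0 ∈ ¬ (denominator L.≈ L.0#) ]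
                  ι a L.≈ z L.* (numerator ÷ denominator [ denominator≉0 ])
    transform = rational K p a (coefficient-vanishing (suc K)) (product-vanishing a-form) p₀≉0 numerator≈ denominator≈

-- Specialisation to the field k(x,y).

module FractionField {c ℓ : Level} (P : IntegralDomain c ℓ) where
  private
    module P = IntegralDomain P
    module Q = IntegralDomain (Fractions.integralDomain P)
  open Fractions P using (Fraction; ι; ι≉0; _÷_[_])
  open SemiringExp Q.semiring using (_^_)
  open CommutativeMonoidSum Q.*-commutativeMonoid using () renaming (sum to ∏)
  open FractionProperties P

  -- The right-hand sides of the clauses defining Fᴾ, F and fibopolynomial.
  recurrence : (x y : P.Carrier) → (ℕ → P.Carrier) → ℕ → P.Carrier
  recurrence x y f n = x P.* f (suc n) P.+ y P.* f n

  negativeIndex : (ℕ → P.Carrier) → (v : Fraction) → (∀ n → ¬ (v ^ n Q.≈ Q.0#)) → ℕ → Fraction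
  negativeIndex f v v^≉0 n = Q.- (ι (f (suc n)) ÷ v ^ suc n [ v^≉0 (suc n) ])

  fibonomial : (F : ℤ → Fraction) →
               (∀ s j .{{_ : NonZero s}} → ¬ (∏ {j} (λ i → F (+ (s * suc (toℕ i)))) Q.≈ Q.0#)) →
               (s n j : ℕ) .{{_ : NonZero s}} → Fraction
  fibonomial F ∏≉0 s n j =
    ∏ {j} (λ i → F (+ (s * (n ∸ toℕ i)))) ÷ ∏ {j} (λ i → F (+ (s * suc (toℕ i)))) [ ∏≉0 s j ]

  -- The defining clauses arrive as propositional equalities about variables, so that the field
  -- operations are reasoned about abstractly and the concrete functions only have to supply
  -- `≡.refl` clause by clause.
  isFibonacci : ∀ {x y f F v} → ¬ (y P.≈ P.0#) → f 0 ≡ P.0# → f 1 ≡ P.1# →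
                (∀ n → f (suc (suc n)) ≡ recurrence x y f n) → (∀ n .{{_ : NonZero n}} → ¬ (f n P.≈ P.0#)) →
                (∀ n → F (+ n) ≡ ι (f n)) → v ≡ Q.- ι y → (v^≉0 : ∀ n → ¬ (v ^ n Q.≈ Q.0#)) →
                (∀ n → F -[1+ n ] ≡ negativeIndex f v v^≉0 n) →
                IsFibonacci (Fractions.integralDomain P) (ι x) (ι y) F
  isFibonacci {x} {y} {f} {F} {v} y≉0 f₀ f₁ f-rec f≉0 F₊ ≡.refl v^≉0 F₋ = record
    { y≉0        = ι≉0 y≉0
    ; F₀≈0       = Q.reflexive (≡.trans (F₊ 0) (≡.cong ι f₀))
    ; F₁≈1       = Q.reflexive (≡.trans (F₊ 1) (≡.cong ι f₁))
    ; F-solution = λ n → solution n (F₊ n) (F₊ (suc n)) (F₊ (suc (suc n)))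
    ; F-negative = λ n → negative n (F₊ (suc n)) (F₋ n)
    ; F≉0        = λ n → ≡.subst (λ p → ¬ (p Q.≈ Q.0#)) (≡.sym (F₊ n)) (ι≉0 (f≉0 n))
    }
    where
    solution : ∀ n {p₀ p₁ p₂} → p₀ ≡ ι (f n) → p₁ ≡ ι (f (suc n)) → p₂ ≡ ι (f (suc (suc n))) →
               p₂ Q.≈ ι x Q.* p₁ Q.+ ι y Q.* p₀
    solution n ≡.refl ≡.refl ≡.refl = Q.trans (Q.reflexive (≡.cong ι (f-rec n))) (ι-linear x (f (suc n)) y (f n))

    negative : ∀ n {p r} → p ≡ ι (f (suc n)) → r ≡ negativeIndex f v v^≉0 n → r Q.* v ^ suc n Q.+ p Q.≈ Q.0#
    negative n ≡.refl ≡.refl = -÷-* (ι (f (suc n))) (v ^ suc n) (v^≉0 (suc n))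

  isFibopolynomial : ∀ {F} {b : (s n j : ℕ) .{{_ : NonZero s}} → Fraction}
                     (∏≉0 : ∀ s j .{{_ : NonZero s}} → ¬ (∏ {j} (λ i → F (+ (s * suc (toℕ i)))) Q.≈ Q.0#)) →
                     (∀ s n j .{{_ : NonZero s}} → b s n j ≡ fibonomial F ∏≉0 s n j) →
                     IsFibopolynomial (Fractions.integralDomain P) F b
  isFibopolynomial {F} ∏≉0 b≡ = record { b-∏ = λ s n j → quotient s n j (b≡ s n j) }
    where
    quotient : ∀ s .{{_ : NonZero s}} n j {p} → p ≡ fibonomial F ∏≉0 s n j →
               p Q.* ∏ {j} (λ i → F (+ (s * suc (toℕ i)))) Q.≈ ∏ {j} (λ i → F (+ (s * (n ∸ toℕ i))))
    quotient s n j ≡.refl =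
      ÷-* (∏ {j} (λ i → F (+ (s * (n ∸ toℕ i))))) (∏ {j} (λ i → F (+ (s * suc (toℕ i))))) (∏≉0 s j)

-- Unfolding nested expressions in the concrete k(x,y)((z⁻¹)) to compare them is infeasible.
-- Hence every operation is a variable here, equal to that of D or of the Laurent series
-- over D; for the concrete field each of these equalities is checked separately.
module TransformAlong≡ {c ℓ : Level} (D : IntegralDomain c ℓ) where
  private
    module D = IntegralDomain D
    module L = IntegralDomain (Fractions.integralDomain (PowerSeries.integralDomain D))
  open D using (Carrier)
  open SemiringExp D.semiring using (_^_)
  open CommutativeMonoidSum D.*-commutativeMonoid using () renaming (sum to ∏)
  open RangeSums (Fractions.integralDomain (PowerSeries.integralDomain D)) using (∑≤)
  open SemiringExp L.semiring using () renaming (_^_ to _^ᴸ_)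
  open LaurentProperties D using (constant) renaming (z to zᴸ)
  open Fractions (PowerSeries.integralDomain D) using (ι; _÷_[_])

  -- The type of the division mentions `0ᶻ`, so its nonvanishing argument is transported along `0≡`.
  -- Once every equality is matched with `≡.refl`, the claim is literally `Transform.transform`.
  transform-along-≡ :
    {_*ᶜ_ : Op₂ Carrier} {_^ᶜ_ : Carrier → ℕ → Carrier} { -1ᶜ : Carrier}
    {∏ᶜ : ∀ n → (Fin n → Carrier) → Carrier}
    {_*ᶻ_ : Op₂ L.Carrier} {_^ᶻ_ : L.Carrier → ℕ → L.Carrier} {z 0ᶻ : L.Carrier}
    {∑ᶻ : ℕ → (ℕ → L.Carrier) → L.Carrier}
    {constᶻ : Carrier → L.Carrier} {𝒵 : (ℕ → Carrier) → L.Carrier}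
    {_÷ᶻ_[_] : (p q : L.Carrier) → ¬ (q L.≈ 0ᶻ) → L.Carrier}
    {x y : Carrier} {F : ℤ → Carrier} {b : (s n j : ℕ) .{{_ : NonZero s}} → Carrier}
    {sign : ℕ → ℕ → Carrier} →
    _*ᶜ_ ≡ D._*_ → _^ᶜ_ ≡ _^_ → -1ᶜ ≡ D.- D.1# → ∏ᶜ ≡ (λ n → ∏ {n}) →
    _*ᶻ_ ≡ L._*_ → _^ᶻ_ ≡ _^ᴸ_ → z ≡ zᴸ → (0≡ : 0ᶻ ≡ L.0#) → ∑ᶻ ≡ ∑≤ → constᶻ ≡ constant → 𝒵 ≡ ι →
    _÷ᶻ_[_] ≡ (λ p q q≉0 → p ÷ q [ ≡.subst (λ o → ¬ (q L.≈ o)) 0≡ q≉0 ]) →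
    IsFibonacci D x y F → IsFibopolynomial D F b →
    (sign ≡ λ s j → -1ᶜ ^ᶜ (((s * j + 2 * (s + 1)) * (j + 1)) / 2)) →
    (s l : ℕ) .{{_ : NonZero s}} (k t : Fin l → ℕ) (m : Fin l → ℤ) →
    let K = sum +-0-commutativeMonoid (λ r → k r * t r)
        numerator = ∑ᶻ K (λ i → ∑ᶻ i (λ j →
          constᶻ (((sign s j *ᶜ b s (K + 1) j)
                    *ᶜ ∏ᶜ l (λ r → F (m r ℤ.+ + (t r * s * (i ∸ j))) ^ᶜ k r))
                    *ᶜ (y ^ᶜ (s * j * (j ∸ 1) / 2)))
            *ᶻ (z ^ᶻ (K ∸ i))))
        denominator = ∑ᶻ (K + 1) (λ i →
          constᶻ ((sign s i *ᶜ b s (K + 1) i) *ᶜ (y ^ᶜ (s * i * (i ∸ 1) / 2)))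
            *ᶻ (z ^ᶻ (K + 1 ∸ i)))
    in Σ[ denominator≉0 ∈ ¬ (denominator L.≈ 0ᶻ) ]
         𝒵 (λ n → ∏ᶜ l (λ r → F (+ (t r * s * n) ℤ.+ m r) ^ᶜ k r))
           L.≈ (z *ᶻ (numerator ÷ᶻ denominator [ denominator≉0 ]))
  transform-along-≡ ≡.refl ≡.refl ≡.refl ≡.refl ≡.refl ≡.refl ≡.refl ≡.refl ≡.refl ≡.refl ≡.refl ≡.refl
    isFibonacci isFibopolynomial ≡.refl s l k t m =
    Transform.transform D isFibonacci isFibopolynomial s k t m

module _ {c ℓ₁ ℓ₂ : Level} (𝕜 : HeytingField c ℓ₁ ℓ₂) where
  open Fibonacci 𝕜
  private
    module P = IntegralDomain k[x,y].integralDomain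
    module C = IntegralDomain k⟨x,y⟩.integralDomain
    open TransformAlong≡ k⟨x,y⟩.integralDomain using (transform-along-≡)
    open FractionField k[x,y].integralDomain using (isFibonacci; isFibopolynomial)

  isFibonacci-F : IsFibonacci k⟨x,y⟩.integralDomain (k⟨x,y⟩.ι xᴾ) y F
  isFibonacci-F = isFibonacci {xᴾ} {yᴾ} {Fᴾ} {F} {C.- y} k[x,y].var≉0 ≡.refl ≡.refl
    (λ n → ≡.refl) Fᴾ≉0 (λ n → ≡.refl) ≡.refl [-y]^≉0 (λ n → ≡.refl)

  isFibopolynomial-F : IsFibopolynomial k⟨x,y⟩.integralDomain F fibopolynomial
  isFibopolynomial-F = isFibopolynomial {F} {fibopolynomial} ∏F≉0 (λ s n j → ≡.refl)

  private
    module S = PowerSeries k⟨x,y⟩.integralDomain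
    module Q = Fractions S.integralDomain
    module L = IntegralDomain Q.integralDomain
    module LP = LaurentProperties k⟨x,y⟩.integralDomain

  -- The implicit operations of transform-along-≡ are read off from these types, so that
  -- its conclusion agrees syntactically with the statement of the theorem.
  *ᶜ-≡ : _*ᶜ_ ≡ C._*_
  *ᶜ-≡ = ≡.refl

  ^ᶜ-≡ : _^ᶜ_ ≡ SemiringExp._^_ C.semiring
  ^ᶜ-≡ = ≡.refl

  -1ᶜ-≡ : -1ᶜ ≡ C.- C.1#
  -1ᶜ-≡ = ≡.refl

  ∏ᶜ-≡ : ∏ᶜ ≡ (λ n → CommutativeMonoidSum.sum C.*-commutativeMonoid {n})
  ∏ᶜ-≡ = ≡.refl

  *ᶻ-≡ : _*ᶻ_ ≡ L._*_
  *ᶻ-≡ = ≡.refl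

  ^ᶻ-≡ : _^ᶻ_ ≡ SemiringExp._^_ L.semiring
  ^ᶻ-≡ = ≡.refl

  z-≡ : z ≡ LP.z
  z-≡ = ≡.refl

  0ᶻ-≡ : 0ᶻ ≡ L.0#
  0ᶻ-≡ = ≡.refl

  ∑ᶻ-≡ : ∑ᶻ ≡ RangeSums.∑≤ Q.integralDomain
  ∑ᶻ-≡ = ≡.refl

  constᶻ-≡ : constᶻ ≡ LP.constant
  constᶻ-≡ = ≡.refl

  𝒵-≡ : 𝒵 ≡ Q.ι
  𝒵-≡ = ≡.refl

  ÷ᶻ-≡ : _÷ᶻ_[_] ≡ (λ p q q≉0 → Q._÷_[_] p q q≉0)
  ÷ᶻ-≡ = ≡.refl

  sign-≡ : sign ≡ (λ s j → -1ᶜ ^ᶜ (((s * j + 2 * (s + 1)) * (j + 1)) / 2))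
  sign-≡ = ≡.refl

  mainTheorem1 :
    (s l : ℕ) .{{_ : NonZero s}} .{{_ : NonZero l}}
    (k t : Fin l → ℕ) (m : Fin l → ℤ) →
    let K = sum +-0-commutativeMonoid (λ r → k r * t r)
        numerator =
          ∑ᶻ[ i ≤ K ] ∑ᶻ[ j ≤ i ]
            (constᶻ (sign s j *ᶜ fibopolynomial s (K + 1) j
                      *ᶜ (∏ᶜ[ r < l ] (F (m r ℤ.+ + (t r * s * (i ∸ j))) ^ᶜ k r))
                      *ᶜ y ^ᶜ (s * j * (j ∸ 1) / 2))
              *ᶻ z ^ᶻ (K ∸ i))
        denominator =
          ∑ᶻ[ i ≤ K + 1 ]
            (constᶻ (sign s i *ᶜ fibopolynomial s (K + 1) i
                      *ᶜ y ^ᶜ (s * i * (i ∸ 1) / 2))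
              *ᶻ z ^ᶻ (K + 1 ∸ i))
    in Σ[ denominator≉0 ∈ ¬ (denominator ≈ᶻ 0ᶻ) ]
         𝒵 (λ n → ∏ᶜ[ r < l ] (F (+ (t r * s * n) ℤ.+ m r) ^ᶜ k r))
           ≈ᶻ z *ᶻ (numerator ÷ᶻ denominator [ denominator≉0 ])
  -- The instance is passed explicitly because an inferred one makes Agda compare the
  -- Fibopolynomials by unfolding.
  mainTheorem1 s l {{s≢0}} k t m = transform-along-≡ *ᶜ-≡ ^ᶜ-≡ -1ᶜ-≡ ∏ᶜ-≡
    *ᶻ-≡ ^ᶻ-≡ z-≡ 0ᶻ-≡ ∑ᶻ-≡ constᶻ-≡ 𝒵-≡ ÷ᶻ-≡ isFibonacci-F isFibopolynomial-F sign-≡ s l {{s≢0}} k t m
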